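{- Let $d$ be the dimension, $D=\binom{d+1}{2}$, let $G=(V,E)$ be a graph, $R$ a multiset of vertices of $V$, and $b^{\circ}:R\to Gr(2,\mathbb{R}^{d+1})$, $r\mapsto[b^\circ_r]$. Then there exists a bar-configuration $b:E\to Gr(2,\mathbb{R}^{d+1})$ such that the $d$-dimensional body-bar framework with bar-boundary $(G,R;b,b^\circ)$ is minimally infinitesimally rigid if and only if (1) $\{b^\circ_r\mid r\in R_v\}$ is linearly independent for each $v\in V$; (2) $|F|+|R_F|\le D|V(F)|-D+\dim(\{b^\circ_r\mid r\in R_F\})$ for every non-empty $F\subseteq E$; (3) $|E|+|R|=D|V|$.
   Context: Graphs are finite and undirected; $V(F)$ is the set of vertices incident to edges of $F\subseteq E$. The multiset $R$ is an indexed family of vertices (elements with different indices are different elements of $R$); $R_v=\{r\in R\mid r=v\}$ and $R_F=\{r\in R\mid r\in V(F)\}$ as multi-subsets. Families such as $\{b^\circ_r\mid r\in R_v\}$ are indexed families of vectors, and $\dim(\cdot)$ of a family is the dimension of its linear span. $Gr(2,\mathbb{R}^{d+1})$ is the Grassmannian of $2$-dimensional linear subspaces, identified via the Plücker embedding with the set of classes $[v_1\wedge v_2]\in\mathbb{P}(\bigwedge^2\mathbb{R}^{d+1})$ of nonzero decomposable elements; $b_e$ (resp. $b^\circ_r$) denotes a representative vector in $\bigwedge^2\mathbb{R}^{d+1}$ of $b(e)$ (resp. $b^\circ(r)$). For $a\in\bigwedge^{d-1}\mathbb{R}^{d+1}$ and $c\in\bigwedge^2\mathbb{R}^{d+1}$,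 $\langle a,c\rangle$ denotes the standard Euclidean inner product $\langle a,*c\rangle$ of $a$ with the Hodge dual of $c$. A $d$-dimensional body-bar framework with bar-boundary is a tuple $(G,R;b,b^\circ)$ with a bar-configuration $b:E\to Gr(2,\mathbb{R}^{d+1})$, $e\mapsto[b_e]$, and a boundary configuration $b^\circ:R\to Gr(2,\mathbb{R}^{d+1})$. An infinitesimal motion is a map $m:V\to\bigwedge^{d-1}\mathbb{R}^{d+1}$ with $\langle m(u)-m(v),b_e\rangle=0$ for all $e=uv\in E$ and $\langle m(v),b^\circ_r\rangle=0$ for all $v\in V$, $r\in R_v$. The framework is infinitesimally rigid if it has no nonzero infinitesimal motion, and minimally infinitesimally rigid if moreover removing any bar (an edge of $E$ or a boundary-bar, i.e. an element of $R$) results in a framework that is not infinitesimally rigid. -}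

module Defs where

open import Level using (Level; _⊔_)
open import Algebra.Bundles using (CommutativeRing)
open import Data.Bool.Base using (if_then_else_)
open import Data.Fin.Base using (Fin; zero; suc)
open import Data.Fin.Properties using (_≟_; any?)
open import Data.Fin.Subset using (Subset; _∈_; ⊤; _-_; ∣_∣)
open import Data.Fin.Subset.Properties using (_∈?_)
open import Data.List.Base using (List; []; _∷_; _++_; foldr; map)
open import Data.Nat.Base using (ℕ; zero; suc; _∸_)
import Data.Nat.Base as ℕ
open import Data.Product.Base using (_×_; ∃; ∃₂)
open import Data.Vec.Base using (lookup; tabulate)
open import Relation.Binary.Core using (Rel)
open import Relation.Binary.Structures using (IsDecTotalOrder)
open import Relation.Nullary using (¬_; does)
open import Relation.Nullary.Decidable using (_×-dec_; _⊎-dec_)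

-- The library has no real numbers, so ℝ enters as an arbitrary complete
-- ordered field; these axioms determine it up to isomorphism.  The reading is
-- the classical one: the order is total and decidable, and *every* inhabited
-- bounded set has a supremum.

record CompleteOrderedField (c ℓ : Level) : Set (Level.suc (c ⊔ ℓ)) where
  field
    commutativeRing : CommutativeRing c ℓ

  open CommutativeRing commutativeRing public

  infix 4 _≤_
  infix 8 _⁻¹

  field
    0≉1             : ¬ (0# ≈ 1#)
    _⁻¹             : Carrier → Carrier
    inverseʳ        : ∀ x → ¬ (x ≈ 0#) → x * x ⁻¹ ≈ 1#
    _≤_             : Rel Carrier ℓ
    isDecTotalOrder : IsDecTotalOrder _≈_ _≤_
    +-mono-≤        : ∀ {x y} z → x ≤ y → x + z ≤ y + z
    *-nonneg        : ∀ {x y} → 0# ≤ x → 0# ≤ y → 0# ≤ x * y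

  UpperBound : (Carrier → Set (c ⊔ ℓ)) → Carrier → Set (c ⊔ ℓ)
  UpperBound P u = ∀ x → P x → x ≤ u

  field
    supremum : ∀ (P : Carrier → Set (c ⊔ ℓ)) → ∃ P → ∃ (UpperBound P) →
               ∃ λ s → UpperBound P s × (∀ u → UpperBound P u → s ≤ u)

-- Finite undirected graphs.  Edges are indexed, so parallel edges (and loops)
-- are allowed.  The two ends of an edge are listed in some order, but no
-- definition below depends on that order.

record Graph : Set where
  field
    #V   : ℕ
    #E   : ℕ
    end₁ : Fin #E → Fin #V
    end₂ : Fin #E → Fin #V

  V E : Set
  V = Fin #V
  E = Fin #E

  V⟨_⟩ : Subset #E → Subset #V
  V⟨ F ⟩ = tabulate λ v →
    does (any? λ e → (e ∈? F) ×-dec ((end₁ e ≟ v) ⊎-dec (end₂ e ≟ v)))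

-- A multiset R of vertices is an indexed family R : Fin ρ → V; its
-- multi-subsets are sets of indices.

  R-at : ∀ {ρ} → (Fin ρ → V) → V → Subset ρ
  R-at R v = tabulate λ r → does (R r ≟ v)

  R-on : ∀ {ρ} → (Fin ρ → V) → Subset #E → Subset ρ
  R-on R F = tabulate λ r → lookup V⟨ F ⟩ (R r)

-- KSubset n k l : subsets of {0,…,n-1} with k elements and l non-elements.

data KSubset : ℕ → ℕ → ℕ → Set where
  []    : KSubset 0 0 0
  in∷_  : ∀ {n k l} → KSubset n k l → KSubset (suc n) (suc k) l
  out∷_ : ∀ {n k l} → KSubset n k l → KSubset (suc n) k (suc l)

-- The elements of I, in increasing order.

element : ∀ {n k l} → KSubset n k l → Fin k → Fin n
element (in∷ I)  zero    = zero
element (in∷ I)  (suc i) = suc (element I i)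
element (out∷ I) i       = suc (element I i)

∁ : ∀ {n k l} → KSubset n k l → KSubset n l k
∁ []       = []
∁ (in∷ I)  = out∷ (∁ I)
∁ (out∷ I) = in∷ (∁ I)

-- The number of pairs (i , j) with i ∈ I, j ∉ I and j < i.

inversions : ∀ {n k l} → KSubset n k l → ℕ
inversions []                = 0
inversions (in∷ I)           = inversions I
inversions (out∷_ {k = k} I) = k ℕ.+ inversions I

mutual
  allKSubsets : ∀ n k l → List (KSubset n k l)
  allKSubsets zero    zero    zero    = [] ∷ []
  allKSubsets zero    zero    (suc l) = []
  allKSubsets zero    (suc k) l       = []
  allKSubsets (suc n) k       l       = startingIn n k l ++ startingOut n k l

  startingIn : ∀ n k l → List (KSubset (suc n) k l)
  startingIn n zero    l = []
  startingIn n (suc k) l = map in∷_ (allKSubsets n k l)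

  startingOut : ∀ n k l → List (KSubset (suc n) k l)
  startingOut n k zero    = []
  startingOut n k (suc l) = map out∷_ (allKSubsets n k l)

module _ {c ℓ : Level} (ℝ : CompleteOrderedField c ℓ) where

  open CompleteOrderedField ℝ using (Carrier; _≈_; _+_; _*_; -_; 0#; 1#; +-monoid)
  open import Algebra.Properties.Monoid.Sum +-monoid using (sum)

  Coords : Set → Set c
  Coords A = A → Carrier

  _≋_ : ∀ {A} → Coords A → Coords A → Set ℓ
  x ≋ y = ∀ a → x a ≈ y a

  𝟎 : ∀ {A} → Coords A
  𝟎 _ = 0#

  -- Linear algebra for the sub-family { x i ∣ i ∈ S } of an indexed family x.

  combination : ∀ {A n} → Subset n → (Fin n → Carrier) → (Fin n → Coords A) → Coords A
  combination S t x a = sum λ i → if lookup S i then t i * x i a else 0#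

  InSpan : ∀ {A n} → Subset n → (Fin n → Coords A) → Coords A → Set (c ⊔ ℓ)
  InSpan S x y = ∃ λ t → combination S t x ≋ y

  LinearlyIndependent : ∀ {A n} → Subset n → (Fin n → Coords A) → Set (c ⊔ ℓ)
  LinearlyIndependent S x =
    ∀ t → combination S t x ≋ 𝟎 → ∀ i → i ∈ S → t i ≈ 0#

  IsBasis : ∀ {A k} → (Coords A → Set (c ⊔ ℓ)) → (Fin k → Coords A) → Set (c ⊔ ℓ)
  IsBasis W y = (∀ j → W (y j)) × LinearlyIndependent ⊤ y × (∀ w → W w → InSpan ⊤ y w)

  HasDimension : ∀ {A} → (Coords A → Set (c ⊔ ℓ)) → ℕ → Set (c ⊔ ℓ)
  HasDimension {A} W k = ∃ λ (y : Fin k → Coords A) → IsBasis W y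

  -- ⋀ n k l is the k-th exterior power of ℝⁿ for n = k + l, in coordinates
  -- with respect to the standard basis e_I = e_{i₁} ∧ … ∧ e_{iₖ}, where
  -- I = {i₁ < … < iₖ}.

  ⋀ : ℕ → ℕ → ℕ → Set c
  ⋀ n k l = Coords (KSubset n k l)

  _∧_ : ∀ {n l} → Coords (Fin n) → Coords (Fin n) → ⋀ n 2 l
  (v ∧ w) I = v i * w j + - (v j * w i)
    where
    i = element I zero
    j = element I (suc zero)

  sign : ℕ → Carrier
  sign zero    = 1#
  sign (suc n) = - sign n

  -- The Hodge dual: ★ e_I = ± e_{∁ I}, with the sign for which
  -- e_I ∧ ★ e_I = e₀ ∧ … ∧ e_{n-1}.

  ★ : ∀ {n k l} → ⋀ n k l → ⋀ n l k
  ★ x J = sign (inversions (∁ J)) * x (∁ J)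

  ⟨_,_⟩ : ∀ {n k l} → ⋀ n k l → ⋀ n k l → Carrier
  ⟨_,_⟩ {n} {k} {l} x y = foldr (λ I s → x I * y I + s) 0# (allKSubsets n k l)

  module _ (d : ℕ) where

    -- A point of Gr(2,ℝᵈ⁺¹) in its Plücker embedding, given by a representative;
    -- representatives that differ by a nonzero scalar denote the same point.

    record Gr₂ : Set (c ⊔ ℓ) where
      field
        rep          : ⋀ (suc d) 2 (d ∸ 1)
        decomposable : ∃₂ λ (v w : Coords (Fin (suc d))) → rep ≋ (v ∧ w)
        nonzero      : ¬ (rep ≋ 𝟎)

    open Gr₂ public

    record Framework : Set (c ⊔ ℓ) where
      constructor framework
      field
        G : Graph
      open Graph G public
      field
        {ρ} : ℕ
        R   : Fin ρ → V
        b   : E → Gr₂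
        b°  : Fin ρ → Gr₂

      -- The bars present are those indexed by A ⊆ E and B ⊆ R, so that removing
      -- a bar means removing its index from A or from B.

      IsInfinitesimalMotion : Subset #E → Subset ρ → (V → ⋀ (suc d) (d ∸ 1) 2) → Set ℓ
      IsInfinitesimalMotion A B m =
        (∀ e → e ∈ A → ⟨ (λ J → m (end₁ e) J + - m (end₂ e) J) , ★ (rep (b e)) ⟩ ≈ 0#) ×
        (∀ v r → r ∈ R-at R v → r ∈ B → ⟨ m v , ★ (rep (b° r)) ⟩ ≈ 0#)

      InfinitesimallyRigid : Subset #E → Subset ρ → Set (c ⊔ ℓ)
      InfinitesimallyRigid A B = ∀ m → IsInfinitesimalMotion A B m → ∀ v → m v ≋ 𝟎

      MinimallyInfinitesimallyRigid : Set (c ⊔ ℓ)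
      MinimallyInfinitesimallyRigid =
        InfinitesimallyRigid ⊤ ⊤ ×
        (∀ e → ¬ InfinitesimallyRigid (⊤ - e) ⊤) ×
        (∀ r → ¬ InfinitesimallyRigid ⊤ (⊤ - r))

{-# OPTIONS --safe #-}

-- A motion is orthogonal to one row ★b_e ⊗ (δ_u − δ_v) for every bar e = uv and
-- one row ★b°_r ⊗ δ_{R r} for every boundary bar, so minimal rigidity means that
-- the rows form a basis of the space of dimension D|V|.  Necessity is then a
-- dimension count.  For sufficiency every b_e is chosen among the coordinate
-- bivectors e_i ∧ e_j: by Rado's theorem an independent choice exists as soon as
-- |F| + |R| is at most the rank of the boundary rows together with all the
-- candidates of the edges in F, for every F.  That rank is the sum, over the components Q of
-- (V , F), of D(|Q| − 1) plus the dimension of the boundary bars at Q, so that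
-- (2), and (1) for isolated vertices, give the bound.
module Submission where

open import Defs
open import Data.Bool.Base using (true; false; if_then_else_)
open import Data.Empty using (⊥-elim)
open import Data.Fin.Base using (Fin; zero; suc) renaming (_<_ to _<ᶠ_)
open import Data.Fin.Properties using (suc-injective; any?)
  renaming (_≟_ to _≟ᶠ_; <-asym to <ᶠ-asym; <-irrefl to <ᶠ-irrefl)
open import Data.Fin.Subset
  using (Subset; inside; outside; ⊤; ⊥; ⁅_⁆; _∈_; _∉_; _⊆_; _∪_; _─_; _-_; ∣_∣; Nonempty; Empty)
open import Data.Fin.Subset.Properties
  using (_∈?_; _⊆?_; nonempty?; anySubset?; Empty-unique; ∉⊥; ∈⊤; ∣⊥∣≡0; ∣⊤∣≡n; ∣⁅x⁆∣≡1; p⊆q⇒∣p∣≤∣q∣; p─q⊆p;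
         x∈p∧x∉q⇒x∈p─q; x∈p∧x≢y⇒x∈p-y; x∈p⇒∣p-x∣<∣p∣; p∩q≢∅⇒∣p─q∣<∣p∣; x∈p∩q⁺; x∈p∪q⁺; x∈p∪q⁻; x∈⁅x⁆; x∈⁅y⁆⇒x≡y)
open import Data.List.Base using (List; []; _∷_; _++_; length; map; concatMap; foldr; cartesianProduct; allFin)
import Data.List.Base as List
open import Data.List.Membership.Propositional using (find; lose) renaming (_∈_ to _∈ˡ_)
open import Data.List.Membership.Propositional.Properties
  using (∈-map⁺; ∈-map⁻; ∈-++⁺ˡ; ∈-++⁺ʳ; ∈-++⁻; ∈-allFin; ∈-cartesianProduct⁺; ∈-cartesianProduct⁻;
         ∈-concatMap⁺; ∈-concatMap⁻; ∈-lookup)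
open import Data.List.Properties using (length-map; length-++; length-tabulate; ++-identityʳ)
open import Data.List.Relation.Unary.All using ([]; _∷_)
import Data.List.Relation.Unary.All as All
open import Data.List.Relation.Unary.Any using (here; there)
import Data.List.Relation.Unary.Any as Any
import Data.List.Relation.Unary.Any.Properties as Any
open import Data.List.Relation.Unary.Unique.Propositional using (Unique; []; _∷_)
import Data.List.Relation.Unary.Unique.Propositional.Properties as Unique
open import Data.Nat.Base using (ℕ; zero; suc; _≤_; _<_; z≤n; s≤s; NonZero)
import Data.Nat.Base as ℕ
import Data.Nat.Properties as ℕ
open import Data.Nat.Combinatorics using (_C_; nCk+nC[k+1]≡[n+1]C[k+1]; nCn≡1; nCk≡nC[n∸k])
open import Data.Product.Base using (_×_; ∃; ∃₂; _,_; proj₁; proj₂)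
open import Data.Product.Properties using (≡-dec)
open import Data.Sum.Base using (_⊎_; inj₁; inj₂; [_,_]′)
open import Data.Vec.Base using ([]; _∷_; here; there; tabulate; lookup)
open import Data.Vec.Properties using (lookup∘tabulate; lookup⇒[]=; []=⇒lookup)
open import Function.Base using (_∘_; id; case_of_)
open import Function.Bundles using (_⇔_; mk⇔)
open import Level using (Level; _⊔_)
open import Relation.Binary.Definitions using (DecidableEquality)
open import Relation.Binary.PropositionalEquality using (_≡_; _≢_; refl; sym; trans; cong; cong₂; subst)
open import Relation.Binary.Structures using (IsDecTotalOrder)
open import Relation.Nullary using (¬_; Dec; yes; no; does)
open import Relation.Nullary.Decidable
  using (¬?; decidable-stable; _×-dec_; _⊎-dec_; dec-true; dec-false; map′)

-- Restricting to coordinate bivectors costs nothing: up to sign their Hodge duals are the standard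
-- basis of the D-dimensional space in which a bar acts, so an edge that offers only these already
-- offers every direction, and each of them is a point of the Grassmannian. Choosing bars thereby
-- becomes a choice from finite families. Two further points shape the proof. Case distinctions on
-- membership in a span have to be decidable; field equality is, and elimination carries this over
-- to spans. And components are not defined by paths: two vertices count as connected when the
-- candidates of `F` span all differences between them, so that connectivity and rank are handled by
-- the same lemmas. The truncated subtraction in (2) is a genuine one, since `V⟨ F ⟩` contains a
-- vertex for nonempty `F`.

record Finite (A : Set) : Set where
  field
    elements : List A
    complete : ∀ a → a ∈ˡ elements
    unique   : Unique elements
    _≟_      : DecidableEquality A

open Finite {{...}}

-- Spans, Gaussian elimination and rank.

module LinearAlgebra {c ℓ : Level} (ℝ : CompleteOrderedField c ℓ) where

  open CompleteOrderedField ℝ hiding (_≤_; refl; sym; trans)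
  open CompleteOrderedField ℝ using () renaming (refl to ≈-refl; sym to ≈-sym; trans to ≈-trans) public
  open IsDecTotalOrder isDecTotalOrder using () renaming (_≟_ to _≈?_) public
  open import Algebra.Solver.Ring.NaturalCoefficients.Default commutativeSemiring
    using (solve; _:+_; _:*_; _:=_; con)

  ⁻¹-cancel : ∀ {s} → ¬ (s ≈ 0#) → ∀ x → s ⁻¹ * (s * x) ≈ x
  ⁻¹-cancel {s} s≉0 x = begin
    s ⁻¹ * (s * x)  ≈⟨ solve 3 (λ a b e → a :* (b :* e) := (b :* a) :* e) ≈-refl (s ⁻¹) s x ⟩
    s * s ⁻¹ * x    ≈⟨ *-congʳ (inverseʳ s s≉0) ⟩
    1# * x          ≈⟨ *-identityˡ x ⟩
    x               ∎
    where open import Relation.Binary.Reasoning.Setoid setoid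

  infix  4 _≐_

  _≐_ : ∀ {A : Set} → (A → Carrier) → (A → Carrier) → Set ℓ
  x ≐ y = ∀ a → x a ≈ y a

  -- Scaling and addition in one operation, so that linearity and closure of spans take a single
  -- clause each.
  axpy : ∀ {A : Set} → Carrier → (A → Carrier) → (A → Carrier) → A → Carrier
  axpy t x y a = t * x a + y a

  𝟘 : ∀ {A : Set} → A → Carrier
  𝟘 _ = 0#

  record IsLinear {A B : Set} (φ : (A → Carrier) → B → Carrier) : Set (c ⊔ ℓ) where
    field
      φ-cong : ∀ {x y} → x ≐ y → φ x ≐ φ y
      φ-𝟘    : φ 𝟘 ≐ 𝟘
      φ-axpy : ∀ t x y → φ (axpy t x y) ≐ axpy t (φ x) (φ y)

  open IsLinear public

  id-linear : ∀ {A : Set} → IsLinear {A} id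
  id-linear = record { φ-cong = id ; φ-𝟘 = λ _ → ≈-refl ; φ-axpy = λ _ _ _ _ → ≈-refl }

  -- A generator may be used repeatedly, so sums of combinations need no merging of coefficients.
  -- The constructors carry `≐` because vectors are functions, equal only up to the `≈` of the
  -- field.
  data Span {A : Set} (L : List (A → Carrier)) (v : A → Carrier) : Set (c ⊔ ℓ) where
    nil  : v ≐ 𝟘 → Span L v
    step : ∀ t {x y} → x ∈ˡ L → Span L y → v ≐ axpy t x y → Span L v

  _⊑_ : ∀ {A : Set} → List (A → Carrier) → List (A → Carrier) → Set (c ⊔ ℓ)
  M ⊑ L = ∀ {x} → x ∈ˡ M → Span L x

  module _ {A : Set} where

    private
      variable
        x y v w : A → Carrier
        L M : List (A → Carrier)

    span-cong : x ≐ y → Span L x → Span L y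
    span-cong x≐y (nil x≐𝟘) = nil λ a → ≈-trans (≈-sym (x≐y a)) (x≐𝟘 a)
    span-cong x≐y (step t w∈L z∈ x≐) = step t w∈L z∈ λ a → ≈-trans (≈-sym (x≐y a)) (x≐ a)

    span-member : x ∈ˡ L → Span L x
    span-member {x = x} x∈L = step 1# x∈L (nil λ _ → ≈-refl)
      λ a → ≈-sym (≈-trans (+-identityʳ _) (*-identityˡ (x a)))

    span-axpy : ∀ t → Span L x → Span L y → Span L (axpy t x y)
    span-axpy {y = y} t (nil x≐𝟘) y∈ = span-cong
      (λ a → ≈-sym (≈-trans (+-congʳ (≈-trans (*-congˡ (x≐𝟘 a)) (zeroʳ t))) (+-identityˡ (y a)))) y∈
    span-axpy {y = y} t (step s {w} {z} w∈L z∈ x≐) y∈ = step (t * s) w∈L (span-axpy t z∈ y∈)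
      λ a → ≈-trans (+-congʳ (*-congˡ (x≐ a)))
        (solve 5 (λ t s w z y → t :* (s :* w :+ z) :+ y := (t :* s) :* w :+ (t :* z :+ y)) ≈-refl
          t s (w a) (z a) (y a))

    span-[] : Span [] x → x ≐ 𝟘
    span-[] (nil x≐𝟘) = x≐𝟘
    span-[] (step _ () _ _)

    span-vanish : ∀ a → (∀ {x} → x ∈ˡ L → x a ≈ 0#) → Span L v → v a ≈ 0#
    span-vanish a L≈0 (nil v≐𝟘) = v≐𝟘 a
    span-vanish a L≈0 (step t x∈L y∈ v≐) = ≈-trans (v≐ a)
      (≈-trans (+-cong (≈-trans (*-congˡ (L≈0 x∈L)) (zeroʳ t)) (span-vanish a L≈0 y∈)) (+-identityˡ 0#))

    -- All occurrences of `w` are gathered into one coefficient `t`; `exchange` divides by it.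
    span-split : Span (w ∷ L) v → ∃₂ λ t z → Span L z × v ≐ axpy t w z
    span-split {w = w} {v = v} (nil v≐𝟘) = 0# , v , nil v≐𝟘 ,
      λ a → ≈-sym (≈-trans (+-congʳ (zeroˡ (w a))) (+-identityˡ (v a)))
    span-split {w = w} (step s (here refl) y∈ v≐) =
      let t , z , z∈ , y≐ = span-split y∈ in
      s + t , z , z∈ , λ a → ≈-trans (v≐ a) (≈-trans (+-congˡ (y≐ a))
        (solve 4 (λ s t w z → s :* w :+ (t :* w :+ z) := (s :+ t) :* w :+ z) ≈-refl s t (w a) (z a)))
    span-split {w = w} (step s {x} (there x∈L) y∈ v≐) =
      let t , z , z∈ , y≐ = span-split y∈ in
      t , axpy s x z , step s x∈L z∈ (λ _ → ≈-refl) , λ a → ≈-trans (v≐ a) (≈-trans (+-congˡ (y≐ a))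
        (solve 5 (λ s t x w z → s :* x :+ (t :* w :+ z) := t :* w :+ (s :* x :+ z)) ≈-refl
          s t (x a) (w a) (z a)))

  -- `M` is any list whose span contains the images of the generators, so taking the identity for
  -- `φ` gives transitivity of spans.
  span-image : ∀ {A B : Set} {φ : (A → Carrier) → B → Carrier} {L M v} → IsLinear φ →
    (∀ {x} → x ∈ˡ L → Span M (φ x)) → Span L v → Span M (φ v)
  span-image lin φL (nil v≐𝟘) = nil λ b → ≈-trans (φ-cong lin v≐𝟘 b) (φ-𝟘 lin b)
  span-image {φ = φ} lin φL (step t {x} {y} x∈L y∈ v≐) = span-cong
    (λ b → ≈-sym (≈-trans (φ-cong lin v≐ b) (φ-axpy lin t x y b)))
    (span-axpy t (φL x∈L) (span-image lin φL y∈))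

  module _ {A : Set} where

    private
      variable
        x y v w : A → Carrier
        L M P : List (A → Carrier)

    span-trans : M ⊑ L → Span M v → Span L v
    span-trans = span-image id-linear

    span-mono : (∀ {x} → x ∈ˡ M → x ∈ˡ L) → Span M v → Span L v
    span-mono M⊆L = span-trans λ x∈M → span-member (M⊆L x∈M)

    ++-⊑ : M ⊑ L → P ⊑ L → (M ++ P) ⊑ L
    ++-⊑ {M = M} M⊑L P⊑L x∈ with ∈-++⁻ M x∈
    ... | inj₁ x∈M = M⊑L x∈M
    ... | inj₂ x∈P = P⊑L x∈P

    ∷-⊑ : Span L x → M ⊑ L → (x ∷ M) ⊑ L
    ∷-⊑ x∈ M⊑L (here refl) = x∈
    ∷-⊑ x∈ M⊑L (there y∈M) = M⊑L y∈M

    -- In `v = t w + z` the coefficient `t` cannot vanish, since `v` would then lie in the span of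
    -- `L`; divide by it.
    exchange : Span (w ∷ L) v → ¬ Span L v → Span (v ∷ L) w
    exchange {w = w} {v = v} v∈ v∉ =
      let t , z , z∈ , v≐ = span-split v∈
          t≉0 = λ t≈0 → v∉ (span-cong
                  (λ a → ≈-sym (≈-trans (v≐ a) (≈-trans (+-congʳ (≈-trans (*-congʳ t≈0) (zeroˡ (w a))))
                    (+-identityˡ (z a))))) z∈)
      in step (t ⁻¹) (here refl) (span-axpy (- (t ⁻¹)) (span-mono there z∈) (nil λ _ → ≈-refl))
        λ a → ≈-sym (begin
          t ⁻¹ * v a + (- (t ⁻¹) * z a + 0#)        ≈⟨ +-congʳ (*-congˡ (v≐ a)) ⟩
          t ⁻¹ * (t * w a + z a) + (- (t ⁻¹) * z a + 0#)
            ≈⟨ solve 5 (λ i n t w z → i :* (t :* w :+ z) :+ (n :* z :+ con 0) := i :* (t :* w) :+ (i :+ n) :* z)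
                 ≈-refl (t ⁻¹) (- (t ⁻¹)) t (w a) (z a) ⟩
          t ⁻¹ * (t * w a) + (t ⁻¹ + - (t ⁻¹)) * z a
            ≈⟨ +-cong (⁻¹-cancel t≉0 (w a)) (≈-trans (*-congʳ (-‿inverseʳ (t ⁻¹))) (zeroˡ (z a))) ⟩
          w a + 0#                                ≈⟨ +-identityʳ (w a) ⟩
          w a                                     ∎)
      where open import Relation.Binary.Reasoning.Setoid setoid

  -- A linear map whose kernel is the span of L: its coordinates are the
  -- functionals that separate L from the vectors outside its span.
  record Quotient {A : Set} (L : List (A → Carrier)) : Set (c ⊔ ℓ) where
    field
      N      : (A → Carrier) → A → Carrier
      linear : IsLinear N
      kills  : ∀ {x} → x ∈ˡ L → N x ≐ 𝟘
      exact  : ∀ {v} → N v ≐ 𝟘 → Span L v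

  module _ {A : Set} {{_ : Finite A}} where

    nonzero? : (x : A → Carrier) → (x ≐ 𝟘) ⊎ (∃ λ a → ¬ (x a ≈ 0#))
    nonzero? x with Any.any? (λ a → ¬? (x a ≈? 0#)) elements
    ... | yes p = let a , _ , xa≉0 = find p in inj₂ (a , xa≉0)
    ... | no ¬p = inj₁ λ a → decidable-stable (x a ≈? 0#) λ xa≉0 →
                    ¬p (lose (complete a) xa≉0)

    -- Used with the image of a new generator as `w` and with minus the inverse of its `i`-th
    -- coordinate as `k`: this is the elimination step that sends the new generator to zero.
    pivot-linear : ∀ {N : (A → Carrier) → A → Carrier} i k w → IsLinear N →
      IsLinear (λ v → axpy (N v i * k) w (N v))
    pivot-linear {N} i k w lin = record
      { φ-cong = λ x≐y a → +-cong (*-congʳ (*-congʳ (φ-cong lin x≐y i))) (φ-cong lin x≐y a)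
      ; φ-𝟘 = λ a → ≈-trans
          (+-cong (*-congʳ (≈-trans (*-congʳ (φ-𝟘 lin i)) (zeroˡ k))) (φ-𝟘 lin a))
          (≈-trans (+-identityʳ _) (zeroˡ (w a)))
      ; φ-axpy = λ t x y a → ≈-trans
          (+-cong (*-congʳ (*-congʳ (φ-axpy lin t x y i))) (φ-axpy lin t x y a))
          (solve 7 (λ t xi yi k w xa ya →
             ((t :* xi :+ yi) :* k) :* w :+ (t :* xa :+ ya)
             := t :* ((xi :* k) :* w :+ xa) :+ ((yi :* k) :* w :+ ya)) ≈-refl
             t (N x i) (N y i) k (w a) (N x a) (N y a))
      }

    -- Elimination, one generator at a time. A generator that is already killed changes nothing;
    -- otherwise a nonzero coordinate of its image serves as pivot.
    quotient : (L : List (A → Carrier)) → Quotient L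
    quotient [] = record { N = id ; linear = id-linear ; kills = λ () ; exact = nil }
    quotient (w ∷ L) with quotient L
    ... | record { N = N ; linear = linear ; kills = kills ; exact = exact } with nonzero? (N w)
    ...   | inj₁ Nw≐𝟘 = record
      { N = N
      ; linear = linear
      ; kills = λ { (here refl) → Nw≐𝟘 ; (there x∈L) → kills x∈L }
      ; exact = λ Nv≐𝟘 → span-mono there (exact Nv≐𝟘)
      }
    ...   | inj₂ (i , Nwi≉0) = record
      { N = λ v → axpy (N v i * k) (N w) (N v)
      ; linear = pivot-linear i k (N w) linear
      ; kills = λ { (here refl) a → pivot-kills a ; (there x∈L) a → rest-killed x∈L a }
      -- The new map sends `v` to the old image of `s w + v` with `s = N v i * k`, so that vector
      -- lies in the span of `L`.
      ; exact = λ {v} N′v≐𝟘 → step (- (N v i * k)) (here refl)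
          (span-mono there (exact λ a → ≈-trans (φ-axpy linear (N v i * k) w v a) (N′v≐𝟘 a)))
          λ a → ≈-sym (≈-trans (solve 4 (λ n s w v → n :* w :+ (s :* w :+ v) := (s :+ n) :* w :+ v) ≈-refl
                         (- (N v i * k)) (N v i * k) (w a) (v a))
                (≈-trans (+-congʳ (≈-trans (*-congʳ (-‿inverseʳ (N v i * k))) (zeroˡ (w a)))) (+-identityˡ (v a))))
      }
      where
      k : Carrier
      k = - (N w i ⁻¹)
      open import Algebra.Properties.Ring ring
        using (-‿distribʳ-*; -‿distribˡ-*)
      pivot-kills : ∀ a → N w i * k * N w a + N w a ≈ 0#
      pivot-kills a = ≈-trans (+-congʳ (≈-trans
          (*-congʳ (≈-trans (≈-sym (-‿distribʳ-* (N w i) (N w i ⁻¹))) (-‿cong (inverseʳ _ Nwi≉0))))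
          (≈-trans (≈-sym (-‿distribˡ-* 1# (N w a))) (-‿cong (*-identityˡ (N w a))))))
        (-‿inverseˡ (N w a))
      rest-killed : ∀ {x} → x ∈ˡ L → ∀ a → N x i * k * N w a + N x a ≈ 0#
      rest-killed x∈L a = ≈-trans
        (+-cong (≈-trans (*-congʳ (≈-trans (*-congʳ (kills x∈L i)) (zeroˡ k))) (zeroˡ (N w a))) (kills x∈L a))
        (+-identityˡ 0#)

    span-killed : ∀ {L : List (A → Carrier)} {v} (q : Quotient L) → Span L v → Quotient.N q v ≐ 𝟘
    span-killed q v∈ = span-[] (span-image (Quotient.linear q) (λ x∈L → nil (Quotient.kills q x∈L)) v∈)

    -- Under the quotient map, membership in a span becomes the vanishing of finitely many field
    -- elements.
    span? : (L : List (A → Carrier)) (v : A → Carrier) → Dec (Span L v)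
    span? L v with quotient L
    ... | q with nonzero? (Quotient.N q v)
    ...   | inj₁ Nv≐𝟘 = yes (Quotient.exact q Nv≐𝟘)
    ...   | inj₂ (a , Nva≉0) = no λ v∈ → Nva≉0 (span-killed q v∈ a)

    extend : ∀ {L : List (A → Carrier)} {v} → Dec (Span L v) → List (A → Carrier) → List (A → Carrier)
    extend (yes _) B = B
    extend {v = v} (no _) B = v ∷ B

    basis : List (A → Carrier) → List (A → Carrier)
    basis []      = []
    basis (v ∷ L) = extend (span? L v) (basis L)

    data Independent : List (A → Carrier) → Set (c ⊔ ℓ) where
      []  : Independent []
      _∷_ : ∀ {v L} → ¬ Span L v → Independent L → Independent (v ∷ L)

    basis⊆ : ∀ L {x} → x ∈ˡ basis L → x ∈ˡ L
    basis⊆ (v ∷ L) x∈ with span? L v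
    basis⊆ (v ∷ L) x∈          | yes _ = there (basis⊆ L x∈)
    basis⊆ (v ∷ L) (here eq)   | no _  = here eq
    basis⊆ (v ∷ L) (there x∈)  | no _  = there (basis⊆ L x∈)

    basis-spans : ∀ L → L ⊑ basis L
    basis-spans (v ∷ L) x∈ with span? L v
    basis-spans (v ∷ L) (here refl) | yes v∈ = span-trans (basis-spans L) v∈
    basis-spans (v ∷ L) (there x∈)  | yes _  = basis-spans L x∈
    basis-spans (v ∷ L) (here refl) | no _   = span-member (here refl)
    basis-spans (v ∷ L) (there x∈)  | no _   = span-mono there (basis-spans L x∈)

    basis-independent : ∀ L → Independent (basis L)
    basis-independent [] = []
    basis-independent (v ∷ L) with span? L v
    ... | yes _ = basis-independent L
    ... | no v∉ = (λ v∈ → v∉ (span-mono (basis⊆ L) v∈)) ∷ basis-independent L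

    -- A member `y` of `P` is kept while `v` is still spanned without it; the first one that cannot
    -- be spared is traded for `v`. Such a member exists because `M` alone does not span `v`.
    exchange-one : ∀ M P {v : A → Carrier} → Span (M ++ P) v → ¬ Span M v →
      ∃ λ P′ → length P ≡ suc (length P′) × (M ++ P) ⊑ (v ∷ M ++ P′)
    exchange-one M [] v∈ v∉ = ⊥-elim (v∉ (subst (λ L → Span L _) (++-identityʳ M) v∈))
    exchange-one M (y ∷ P) {v} v∈ v∉ with span? (M ++ P) v
    ... | yes v∈′ =
      let P′ , len , MP⊑ = exchange-one M P v∈′ v∉
          lift = λ {x} → span-mono {v = x} λ { (here eq) → here eq ; (there z∈) → there (weaken M z∈) }
      in y ∷ P′ , cong suc len ,
         ++-⊑ (λ x∈M → span-member (there (∈-++⁺ˡ x∈M)))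
              (∷-⊑ (span-member (there (∈-++⁺ʳ M (here refl))))
                   (λ x∈P → lift (MP⊑ (∈-++⁺ʳ M x∈P))))
      where
      weaken : ∀ M {P′ z} → z ∈ˡ M ++ P′ → z ∈ˡ M ++ y ∷ P′
      weaken M z∈ with ∈-++⁻ M z∈
      ... | inj₁ z∈M = ∈-++⁺ˡ z∈M
      ... | inj₂ z∈P = ∈-++⁺ʳ M (there z∈P)
    ... | no v∉′ = P , refl ,
         ++-⊑ (λ x∈M → span-member (there (∈-++⁺ˡ x∈M)))
              (∷-⊑ (exchange (span-trans front v∈) v∉′)
                   (λ x∈P → span-member (there (∈-++⁺ʳ M x∈P))))
      where
      front : (M ++ y ∷ P) ⊑ (y ∷ M ++ P)
      front = ++-⊑ (λ x∈M → span-member (there (∈-++⁺ˡ x∈M)))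
                   (∷-⊑ (span-member (here refl)) (λ x∈P → span-member (there (∈-++⁺ʳ M x∈P))))

    -- `P` is what remains of `L` after each vector of `M` has displaced one of its members.
    steinitz : ∀ {M L : List (A → Carrier)} → Independent M → M ⊑ L →
      ∃ λ P → length M ℕ.+ length P ≡ length L × L ⊑ (M ++ P)
    steinitz {L = L} [] M⊑L = L , refl , span-member
    steinitz (v∉ ∷ ind) M⊑L with steinitz ind (M⊑L ∘ there)
    steinitz {v ∷ M} (v∉ ∷ ind) M⊑L | P , len , L⊑
      with exchange-one M P (span-trans L⊑ (M⊑L (here refl))) v∉
    ... | P′ , len′ , MP⊑ = P′ ,
      trans (sym (ℕ.+-suc (length M) (length P′))) (trans (cong (length M ℕ.+_) (sym len′)) len) ,
      λ x∈L → span-trans MP⊑ (L⊑ x∈L)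

    independent-length : ∀ {M L : List (A → Carrier)} → Independent M → M ⊑ L → length M ≤ length L
    independent-length {M} ind M⊑L =
      let P , len , _ = steinitz ind M⊑L in subst (length M ≤_) len (ℕ.m≤m+n _ _)

    opaque

      -- Sealed, because only the inequalities of this block matter later. The greedy `basis`
      -- depends on the order of the list; by `rk-mono` its length depends on the span alone.
      rk : List (A → Carrier) → ℕ
      rk L = length (basis L)

      rk-[] : rk [] ≡ 0
      rk-[] = refl

      length-basis : ∀ L → length (basis L) ≡ rk L
      length-basis L = refl

      rk-mono : ∀ {M L} → M ⊑ L → rk M ≤ rk L
      rk-mono {M} {L} M⊑L = independent-length (basis-independent M)
        (λ x∈ → span-trans (basis-spans L) (M⊑L (basis⊆ M x∈)))

      rk≤length : ∀ L → rk L ≤ length L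
      rk≤length L = independent-length (basis-independent L) (λ x∈ → span-member (basis⊆ L x∈))

      rk-∉ : ∀ {L v} → ¬ Span L v → rk (v ∷ L) ≡ suc (rk L)
      rk-∉ {L} {v} v∉ with span? L v
      ... | yes v∈ = ⊥-elim (v∉ v∈)
      ... | no _   = refl

      rk-∷≤ : ∀ v L → rk (v ∷ L) ≤ suc (rk L)
      rk-∷≤ v L with span? L v
      ... | yes _ = ℕ.n≤1+n _
      ... | no _  = ℕ.≤-refl

    rk-++≤ : ∀ M L → rk (M ++ L) ≤ length M ℕ.+ rk L
    rk-++≤ []      L = ℕ.≤-refl
    rk-++≤ (v ∷ M) L = ℕ.≤-trans (rk-∷≤ v (M ++ L)) (s≤s (rk-++≤ M L))

    -- A vector of `L` outside the span of `M` would raise the rank of `M` above that of `L`.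
    rk-spanning : ∀ {M L} → M ⊑ L → rk L ≤ rk M → L ⊑ M
    rk-spanning {M} {L} M⊑L rk≤ {x} x∈L = decidable-stable (span? M x) λ x∉M →
      ℕ.<⇒≱ (ℕ.≤-trans (ℕ.≤-reflexive (sym (rk-∉ x∉M))) (rk-mono (∷-⊑ (span-member x∈L) M⊑L))) rk≤

    -- The list `js` of other indices is arbitrary, so that the hypothesis for `is` passes to its
    -- tail; each further head then raises the rank by one. Keeping a base `B` allows edges to be
    -- counted on top of boundary bars.
    rk-irredundant : ∀ {I : Set} {x : I → A → Carrier} {is : List I} {B} → Unique is →
      (∀ {i js} → i ∈ˡ is → (∀ {j} → j ∈ˡ js → j ∈ˡ is × j ≢ i) → ¬ Span (map x js ++ B) (x i)) →
      length is ℕ.+ rk B ≤ rk (map x is ++ B)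
    rk-irredundant [] _ = ℕ.≤-refl
    rk-irredundant {x = x} {is = i ∷ is} {B} (i∉ ∷ un) irr = ℕ.≤-trans
      (s≤s (rk-irredundant un λ i∈ js → irr (there i∈) λ j∈ → let j∈is , j≢i = js j∈ in there j∈is , j≢i))
      (ℕ.≤-reflexive (sym (rk-∉ (irr (here refl)
        λ j∈ → there j∈ , λ { refl → All.lookup i∉ j∈ refl }))))

  -- One half of rank-nullity: a vector whose image is new among the images of `M` is also new
  -- modulo the kernel vectors `P`. Ranks of separate pieces are added in this way, by means of
  -- `total` and `restrict`.
  rk-linear : ∀ {A B : Set} {{_ : Finite A}} {{_ : Finite B}} {φ : (A → Carrier) → B → Carrier} →
    IsLinear φ → ∀ M {P} → (∀ {x} → x ∈ˡ P → φ x ≐ 𝟘) → rk (map φ M) ℕ.+ rk P ≤ rk (M ++ P)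
  rk-linear lin [] {P} P≐𝟘 = ℕ.≤-reflexive (cong (ℕ._+ rk P) rk-[])
  rk-linear {φ = φ} lin (v ∷ M) {P} P≐𝟘 with span? (map φ M) (φ v)
  ... | yes φv∈ = begin
    rk (φ v ∷ map φ M) ℕ.+ rk P  ≤⟨ ℕ.+-monoˡ-≤ (rk P) (rk-mono (∷-⊑ φv∈ span-member)) ⟩
    rk (map φ M) ℕ.+ rk P        ≤⟨ rk-linear lin M P≐𝟘 ⟩
    rk (M ++ P)                  ≤⟨ rk-mono (λ x∈ → span-member (there x∈)) ⟩
    rk (v ∷ M ++ P)              ∎
    where open ℕ.≤-Reasoning
  ... | no φv∉ = begin
    rk (φ v ∷ map φ M) ℕ.+ rk P    ≡⟨ cong (ℕ._+ rk P) (rk-∉ φv∉) ⟩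
    suc (rk (map φ M) ℕ.+ rk P)    ≤⟨ s≤s (rk-linear lin M P≐𝟘) ⟩
    suc (rk (M ++ P))              ≡⟨ rk-∉ (λ v∈ → φv∉ (span-image lin (λ x∈ → image (∈-++⁻ M x∈)) v∈)) ⟨
    rk (v ∷ M ++ P)                ∎
    where
    open ℕ.≤-Reasoning
    image : ∀ {x} → x ∈ˡ M ⊎ x ∈ˡ P → Span (map φ M) (φ x)
    image (inj₁ x∈M) = span-member (∈-map⁺ φ x∈M)
    image (inj₂ x∈P) = nil (P≐𝟘 x∈P)

-- Subsets as duplicate-free lists, and their sizes.

members : ∀ {n} → Subset n → List (Fin n)
members []            = []
members (inside  ∷ S) = zero ∷ map suc (members S)
members (outside ∷ S) = map suc (members S)

∈-members⁺ : ∀ {n} {S : Subset n} {i} → i ∈ S → i ∈ˡ members S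
∈-members⁺ {S = inside  ∷ S} here        = here refl
∈-members⁺ {S = inside  ∷ S} (there i∈S) = there (∈-map⁺ suc (∈-members⁺ i∈S))
∈-members⁺ {S = outside ∷ S} (there i∈S) = ∈-map⁺ suc (∈-members⁺ i∈S)

∈-members⁻ : ∀ {n} {S : Subset n} {i} → i ∈ˡ members S → i ∈ S
∈-members⁻ {S = inside ∷ S} (here refl) = here
∈-members⁻ {S = inside ∷ S} (there i∈) with ∈-map⁻ suc i∈
... | _ , j∈ , refl = there (∈-members⁻ j∈)
∈-members⁻ {S = outside ∷ S} i∈ with ∈-map⁻ suc i∈
... | _ , j∈ , refl = there (∈-members⁻ j∈)

length-members : ∀ {n} (S : Subset n) → length (members S) ≡ ∣ S ∣
length-members []            = refl
length-members (inside  ∷ S) = cong suc (trans (length-map suc (members S)) (length-members S))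
length-members (outside ∷ S) = trans (length-map suc (members S)) (length-members S)

members-unique : ∀ {n} (S : Subset n) → Unique (members S)
members-unique [] = []
members-unique (inside ∷ S) =
  All.tabulate (λ { i∈ refl → zero∉map-suc i∈ }) ∷ Unique.map⁺ suc-injective (members-unique S)
  where
  zero∉map-suc : ¬ (zero ∈ˡ map suc (members S))
  zero∉map-suc z∈ with ∈-map⁻ suc z∈
  ... | _ , _ , ()
members-unique (outside ∷ S) = Unique.map⁺ suc-injective (members-unique S)

∣∪∣≤ : ∀ {n} (p q : Subset n) → ∣ p ∪ q ∣ ≤ ∣ p ∣ ℕ.+ ∣ q ∣
∣∪∣≤ []            []            = z≤n
∣∪∣≤ (inside  ∷ p) (inside  ∷ q) = s≤s (ℕ.≤-trans (∣∪∣≤ p q) (ℕ.+-monoʳ-≤ ∣ p ∣ (ℕ.n≤1+n ∣ q ∣)))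
∣∪∣≤ (inside  ∷ p) (outside ∷ q) = s≤s (∣∪∣≤ p q)
∣∪∣≤ (outside ∷ p) (inside  ∷ q) = ℕ.≤-trans (s≤s (∣∪∣≤ p q)) (ℕ.≤-reflexive (sym (ℕ.+-suc ∣ p ∣ ∣ q ∣)))
∣∪∣≤ (outside ∷ p) (outside ∷ q) = ∣∪∣≤ p q

∣∪∣-disjoint : ∀ {n} (p q : Subset n) → (∀ {i} → i ∈ p → i ∉ q) → ∣ p ∣ ℕ.+ ∣ q ∣ ≤ ∣ p ∪ q ∣
∣∪∣-disjoint []            []            dis = z≤n
∣∪∣-disjoint (inside  ∷ p) (inside  ∷ q) dis = ⊥-elim (dis here here)
∣∪∣-disjoint (inside  ∷ p) (outside ∷ q) dis = s≤s (∣∪∣-disjoint p q λ i∈p → dis (there i∈p) ∘ there)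
∣∪∣-disjoint (outside ∷ p) (inside  ∷ q) dis = ℕ.≤-trans (ℕ.≤-reflexive (ℕ.+-suc ∣ p ∣ ∣ q ∣))
  (s≤s (∣∪∣-disjoint p q λ i∈p → dis (there i∈p) ∘ there))
∣∪∣-disjoint (outside ∷ p) (outside ∷ q) dis = ∣∪∣-disjoint p q λ i∈p → dis (there i∈p) ∘ there

x∈p─q⇒x∉q : ∀ {n} {p q : Subset n} {i} → i ∈ p ─ q → i ∉ q
x∈p─q⇒x∉q {p = x ∷ p} {inside ∷ q}  (there i∈) (there i∈q) = x∈p─q⇒x∉q i∈ i∈q
x∈p─q⇒x∉q {p = x ∷ p} {outside ∷ q} (there i∈) (there i∈q) = x∈p─q⇒x∉q i∈ i∈q

∣S∣≤∣S─T∣+∣T∣ : ∀ {n} (S T : Subset n) → ∣ S ∣ ≤ ∣ S ─ T ∣ ℕ.+ ∣ T ∣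
∣S∣≤∣S─T∣+∣T∣ S T = ℕ.≤-trans (p⊆q⇒∣p∣≤∣q∣ split) (∣∪∣≤ (S ─ T) T)
  where
  split : S ⊆ (S ─ T) ∪ T
  split {i} i∈S with i ∈? T
  ... | yes i∈T = x∈p∪q⁺ (inj₂ i∈T)
  ... | no i∉T  = x∈p∪q⁺ (inj₁ (x∈p∧x∉q⇒x∈p─q i∈S i∉T))

Empty⇒∣S∣≡0 : ∀ {n} {S : Subset n} → Empty S → ∣ S ∣ ≡ 0
Empty⇒∣S∣≡0 {n} e = trans (cong ∣_∣ (Empty-unique e)) (∣⊥∣≡0 n)

-- Rado's theorem on independent transversals.

module Rado {c ℓ : Level} (ℝ : CompleteOrderedField c ℓ) where

  open CompleteOrderedField ℝ using (Carrier)
  open LinearAlgebra ℝ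

  module _ {A J : Set} {{_ : Finite A}} {{_ : Finite J}} {m : ℕ} (cand : Fin m → J → A → Carrier) where

    spread : Subset m → List (A → Carrier)
    spread F = concatMap (λ e → map (cand e) elements) (members F)

    chosen : (Fin m → J) → Subset m → List (A → Carrier)
    chosen f S = map (λ e → cand e (f e)) (members S)

    ∈-spread⁺ : ∀ {F e} j → e ∈ F → cand e j ∈ˡ spread F
    ∈-spread⁺ {e = e} j e∈F =
      ∈-concatMap⁺ (λ e → map (cand e) elements) (lose (∈-members⁺ e∈F) (∈-map⁺ (cand e) (complete j)))

    ∈-spread⁻ : ∀ {F x} → x ∈ˡ spread F → ∃₂ λ e j → e ∈ F × x ≡ cand e j
    ∈-spread⁻ {F} x∈ with find (∈-concatMap⁻ (λ e → map (cand e) elements) {xs = members F} x∈)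
    ... | e , e∈ , x∈′ with ∈-map⁻ (cand e) x∈′
    ... | j , _ , eq = e , j , ∈-members⁻ e∈ , eq

    ∈-chosen⁺ : ∀ {f S e} → e ∈ S → cand e (f e) ∈ˡ chosen f S
    ∈-chosen⁺ {f} e∈S = ∈-map⁺ (λ e → cand e (f e)) (∈-members⁺ e∈S)

    ∈-chosen⁻ : ∀ {f S x} → x ∈ˡ chosen f S → ∃ λ e → e ∈ S × x ≡ cand e (f e)
    ∈-chosen⁻ {f} x∈ with ∈-map⁻ (λ e → cand e (f e)) x∈
    ... | e , e∈ , eq = e , ∈-members⁻ e∈ , eq

    length-chosen : ∀ f S → length (chosen f S) ≡ ∣ S ∣
    length-chosen f S = trans (length-map (λ e → cand e (f e)) (members S)) (length-members S)

    -- Rado's condition in the contraction by `B`. Measuring against `rk B` lets the induction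
    -- enlarge `B` by vectors that are already chosen.
    Hall : List (A → Carrier) → Subset m → Set
    Hall B S = ∀ F → F ⊆ S → ∣ F ∣ ℕ.+ rk B ≤ rk (spread F ++ B)

    Tight : List (A → Carrier) → Subset m → Subset m → Set
    Tight B S T = T ⊆ S × Nonempty T × ∣ T ∣ < ∣ S ∣ × rk (spread T ++ B) ≤ ∣ T ∣ ℕ.+ rk B

    module _ (j₀ : J) where

      -- The Halmos–Vaughan induction: if some proper nonempty part is tight, solve
      -- it and contract its span; otherwise every candidate outside the span of B
      -- can be chosen for an arbitrary index.
      rado : ∀ n S B → ∣ S ∣ ≤ n → Hall B S → ∃ λ f → ∣ S ∣ ℕ.+ rk B ≤ rk (chosen f S ++ B)
      rado-step : ∀ n S B → ∣ S ∣ ≤ suc n → Hall B S → Nonempty S → Dec (∃ (Tight B S)) →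
        ∃ λ f → ∣ S ∣ ℕ.+ rk B ≤ rk (chosen f S ++ B)

      rado-empty : ∀ S B → ∣ S ∣ ≡ 0 → ∃ λ f → ∣ S ∣ ℕ.+ rk B ≤ rk (chosen f S ++ B)
      rado-empty S B ∣S∣≡0 = (λ _ → j₀) , subst (λ k → k ℕ.+ rk B ≤ rk (chosen (λ _ → j₀) S ++ B)) (sym ∣S∣≡0)
        (rk-mono λ x∈ → span-member (∈-++⁺ʳ (chosen (λ _ → j₀) S) x∈))

      rado zero S B ∣S∣≤0 hall = rado-empty S B (ℕ.n≤0⇒n≡0 ∣S∣≤0)
      rado (suc n) S B ∣S∣≤n hall with nonempty? S
      ... | no empty = rado-empty S B (Empty⇒∣S∣≡0 empty)
      ... | yes ne = rado-step n S B ∣S∣≤n hall ne (anySubset? λ T →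
              T ⊆? S ×-dec nonempty? T ×-dec (∣ T ∣ ℕ.<? ∣ S ∣) ×-dec (rk (spread T ++ B) ℕ.≤? ∣ T ∣ ℕ.+ rk B))

      rado-step n S B ∣S∣≤n hall ne (yes (T , T⊆S , (e , e∈T) , ∣T∣<∣S∣ , tight)) = f , bound
        where
        open ℕ.≤-Reasoning
        first = rado n T B (ℕ.≤-pred (ℕ.≤-trans ∣T∣<∣S∣ ∣S∣≤n)) λ F F⊆T → hall F (T⊆S ∘ F⊆T)
        f₁ = proj₁ first
        B′ = chosen f₁ T ++ B
        B′⊑ : B′ ⊑ (spread T ++ B)
        B′⊑ = ++-⊑ (λ x∈ → fromChosen (∈-chosen⁻ x∈)) (λ x∈ → span-member (∈-++⁺ʳ (spread T) x∈))
          where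
          fromChosen : ∀ {x} → (∃ λ e → e ∈ T × x ≡ cand e (f₁ e)) → Span (spread T ++ B) x
          fromChosen (e , e∈ , refl) = span-member (∈-++⁺ˡ (∈-spread⁺ (f₁ e) e∈))
        -- By tightness the vectors chosen for `T` reach the full rank of the candidates of `T`, so
        -- contracting the chosen ones contracts all of them.
        ⊑B′ : (spread T ++ B) ⊑ B′
        ⊑B′ = rk-spanning B′⊑ (ℕ.≤-trans tight (proj₂ first))
        rkB′≤ : rk B′ ≤ ∣ T ∣ ℕ.+ rk B
        rkB′≤ = subst (λ k → rk B′ ≤ k ℕ.+ rk B) (length-chosen f₁ T) (rk-++≤ (chosen f₁ T) B)
        -- This is the condition for the disjoint union `K ∪ T`, with the candidates of `T` absorbed
        -- by `B′`.
        hall′ : Hall B′ (S ─ T)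
        hall′ K K⊆ = begin
          ∣ K ∣ ℕ.+ rk B′                  ≤⟨ ℕ.+-monoʳ-≤ ∣ K ∣ rkB′≤ ⟩
          ∣ K ∣ ℕ.+ (∣ T ∣ ℕ.+ rk B)       ≡⟨ ℕ.+-assoc ∣ K ∣ ∣ T ∣ (rk B) ⟨
          ∣ K ∣ ℕ.+ ∣ T ∣ ℕ.+ rk B         ≤⟨ ℕ.+-monoˡ-≤ (rk B) (∣∪∣-disjoint K T (x∈p─q⇒x∉q ∘ K⊆)) ⟩
          ∣ K ∪ T ∣ ℕ.+ rk B               ≤⟨ hall (K ∪ T) (λ i∈ → [ p─q⊆p S T ∘ K⊆ , T⊆S ]′ (x∈p∪q⁻ K T i∈)) ⟩
          rk (spread (K ∪ T) ++ B)         ≤⟨ rk-mono (++-⊑ (λ x∈ → fromSpread (∈-spread⁻ x∈))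
                                                (λ x∈ → span-member (∈-++⁺ʳ (spread K) (∈-++⁺ʳ (chosen f₁ T) x∈)))) ⟩
          rk (spread K ++ B′)              ∎
          where
          fromSpread : ∀ {x} → (∃₂ λ e j → e ∈ K ∪ T × x ≡ cand e j) → Span (spread K ++ B′) x
          fromSpread (e , j , e∈ , refl) with x∈p∪q⁻ K T e∈
          ... | inj₁ e∈K = span-member (∈-++⁺ˡ (∈-spread⁺ j e∈K))
          ... | inj₂ e∈T = span-mono (∈-++⁺ʳ (spread K)) (⊑B′ (∈-++⁺ˡ (∈-spread⁺ j e∈T)))
        second = rado n (S ─ T) B′
          (ℕ.≤-pred (ℕ.≤-trans (p∩q≢∅⇒∣p─q∣<∣p∣ S T (e , x∈p∩q⁺ (T⊆S e∈T , e∈T))) ∣S∣≤n)) hall′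
        f₂ = proj₁ second
        f = λ i → if does (i ∈? T) then f₁ i else f₂ i
        f-in : ∀ {i} → i ∈ T → f i ≡ f₁ i
        f-in {i} i∈T = cong (if_then f₁ i else f₂ i) (dec-true (i ∈? T) i∈T)
        f-out : ∀ {i} → i ∉ T → f i ≡ f₂ i
        f-out {i} i∉T = cong (if_then f₁ i else f₂ i) (dec-false (i ∈? T) i∉T)
        member : ∀ {i j} → i ∈ S → f i ≡ j → cand i j ∈ˡ chosen f S ++ B
        member i∈S refl = ∈-++⁺ˡ (∈-chosen⁺ i∈S)
        fromFirst : ∀ {x} → (∃ λ e → e ∈ T × x ≡ cand e (f₁ e)) → Span (chosen f S ++ B) x
        fromFirst (_ , i∈T , refl) = span-member (member (T⊆S i∈T) (f-in i∈T))
        fromSecond : ∀ {x} → (∃ λ e → e ∈ S ─ T × x ≡ cand e (f₂ e)) → Span (chosen f S ++ B) x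
        fromSecond (_ , i∈ , refl) = span-member (member (p─q⊆p S T i∈) (f-out (x∈p─q⇒x∉q i∈)))
        bound : ∣ S ∣ ℕ.+ rk B ≤ rk (chosen f S ++ B)
        bound = begin
          ∣ S ∣ ℕ.+ rk B                        ≤⟨ ℕ.+-monoˡ-≤ (rk B) (∣S∣≤∣S─T∣+∣T∣ S T) ⟩
          ∣ S ─ T ∣ ℕ.+ ∣ T ∣ ℕ.+ rk B          ≡⟨ ℕ.+-assoc ∣ S ─ T ∣ ∣ T ∣ (rk B) ⟩
          ∣ S ─ T ∣ ℕ.+ (∣ T ∣ ℕ.+ rk B)        ≤⟨ ℕ.+-monoʳ-≤ ∣ S ─ T ∣ (proj₂ first) ⟩
          ∣ S ─ T ∣ ℕ.+ rk B′                   ≤⟨ proj₂ second ⟩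
          rk (chosen f₂ (S ─ T) ++ B′)          ≤⟨ rk-mono (++-⊑ (λ x∈ → fromSecond (∈-chosen⁻ x∈))
                                                     (++-⊑ (λ x∈ → fromFirst (∈-chosen⁻ x∈))
                                                       (λ x∈ → span-member (∈-++⁺ʳ (chosen f S) x∈)))) ⟩
          rk (chosen f S ++ B)                  ∎

      rado-step n S B ∣S∣≤n hall (e , e∈S) (no ¬tight) with Any.any? (λ j → ¬? (span? B (cand e j))) elements
      -- If `B` spanned every candidate of `e`, the condition for `⁅ e ⁆` would fail.
      ... | no all∈ = ⊥-elim (ℕ.<⇒≱ (begin-strict
          rk B                         <⟨ ℕ.n<1+n (rk B) ⟩
          1 ℕ.+ rk B                   ≡⟨ cong (ℕ._+ rk B) (∣⁅x⁆∣≡1 e) ⟨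
          ∣ ⁅ e ⁆ ∣ ℕ.+ rk B           ≤⟨ hall ⁅ e ⁆ (λ i∈ → subst (_∈ S) (sym (x∈⁅y⁆⇒x≡y e i∈)) e∈S) ⟩
          rk (spread ⁅ e ⁆ ++ B)       ∎) (rk-mono (++-⊑ (λ x∈ → fromSpread (∈-spread⁻ x∈)) span-member)))
        where
        open ℕ.≤-Reasoning
        fromSpread : ∀ {x} → (∃₂ λ i j → i ∈ ⁅ e ⁆ × x ≡ cand i j) → Span B x
        fromSpread (i , j , i∈ , refl) with x∈⁅y⁆⇒x≡y e i∈
        ... | refl = decidable-stable (span? B (cand e j)) λ ∉B → all∈ (lose (complete j) ∉B)
      ... | yes some with find some
      ...   | j , _ , j∉ = f , bound
        where
        open ℕ.≤-Reasoning
        B′ = cand e j ∷ B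
        B⊑ : ∀ L → B ⊑ (L ++ B′)
        B⊑ L x∈ = span-member (∈-++⁺ʳ L (there x∈))
        -- For nonempty `K` the absence of tight sets makes the inequality strict, which pays for
        -- `rk B′` being one more than `rk B`. The empty set is excluded from `Tight` and is treated
        -- apart.
        hall′ : Hall B′ (S - e)
        hall′ K K⊆ with nonempty? K
        ... | no empty = begin
          ∣ K ∣ ℕ.+ rk B′          ≡⟨ cong (ℕ._+ rk B′) (Empty⇒∣S∣≡0 empty) ⟩
          rk B′                    ≤⟨ rk-mono (λ x∈ → span-member (∈-++⁺ʳ (spread K) x∈)) ⟩
          rk (spread K ++ B′)      ∎
        ... | yes neK = begin
          ∣ K ∣ ℕ.+ rk B′          ≡⟨ cong (∣ K ∣ ℕ.+_) (rk-∉ j∉) ⟩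
          ∣ K ∣ ℕ.+ suc (rk B)     ≡⟨ ℕ.+-suc ∣ K ∣ (rk B) ⟩
          suc (∣ K ∣ ℕ.+ rk B)     ≤⟨ ℕ.≰⇒> (λ t → ¬tight (K , p─q⊆p S ⁅ e ⁆ ∘ K⊆ , neK ,
                                        ℕ.≤-<-trans (p⊆q⇒∣p∣≤∣q∣ K⊆) (x∈p⇒∣p-x∣<∣p∣ e∈S) , t)) ⟩
          rk (spread K ++ B)       ≤⟨ rk-mono (++-⊑ (λ x∈ → span-member (∈-++⁺ˡ x∈)) (B⊑ (spread K))) ⟩
          rk (spread K ++ B′)      ∎
        rest = rado n (S - e) B′ (ℕ.≤-pred (ℕ.≤-trans (x∈p⇒∣p-x∣<∣p∣ e∈S) ∣S∣≤n)) hall′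
        f₂ = proj₁ rest
        f = λ i → if does (i ≟ᶠ e) then j else f₂ i
        member : ∀ {i k} → i ∈ S → f i ≡ k → cand i k ∈ˡ chosen f S ++ B
        member i∈S refl = ∈-++⁺ˡ (∈-chosen⁺ i∈S)
        fromRest : ∀ {x} → (∃ λ i → i ∈ S - e × x ≡ cand i (f₂ i)) → Span (chosen f S ++ B) x
        fromRest (i , i∈ , refl) = span-member (member (p─q⊆p S ⁅ e ⁆ i∈)
          (cong (if_then j else f₂ i) (dec-false (i ≟ᶠ e) λ { refl → x∈p─q⇒x∉q i∈ (x∈⁅x⁆ e) })))
        bound : ∣ S ∣ ℕ.+ rk B ≤ rk (chosen f S ++ B)
        bound = begin
          ∣ S ∣ ℕ.+ rk B                         ≤⟨ ℕ.+-monoˡ-≤ (rk B) (∣S∣≤∣S─T∣+∣T∣ S ⁅ e ⁆) ⟩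
          ∣ S - e ∣ ℕ.+ ∣ ⁅ e ⁆ ∣ ℕ.+ rk B       ≡⟨ ℕ.+-assoc ∣ S - e ∣ ∣ ⁅ e ⁆ ∣ (rk B) ⟩
          ∣ S - e ∣ ℕ.+ (∣ ⁅ e ⁆ ∣ ℕ.+ rk B)     ≡⟨ cong (λ k → ∣ S - e ∣ ℕ.+ (k ℕ.+ rk B)) (∣⁅x⁆∣≡1 e) ⟩
          ∣ S - e ∣ ℕ.+ suc (rk B)               ≡⟨ cong (∣ S - e ∣ ℕ.+_) (rk-∉ j∉) ⟨
          ∣ S - e ∣ ℕ.+ rk B′                    ≤⟨ proj₂ rest ⟩
          rk (chosen f₂ (S - e) ++ B′)           ≤⟨ rk-mono (++-⊑ (λ x∈ → fromRest (∈-chosen⁻ x∈))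
                                                      (∷-⊑ (span-member (member e∈S
                                                         (cong (if_then j else f₂ e) (dec-true (e ≟ᶠ e) refl))))
                                                        (λ x∈ → span-member (∈-++⁺ʳ (chosen f S) x∈)))) ⟩
          rk (chosen f S ++ B)                   ∎

-- Finite index types, and the number of subsets of a given size.

instance
  Fin-finite : ∀ {n} → Finite (Fin n)
  Fin-finite {n} = record
    { elements = allFin n ; complete = ∈-allFin ; unique = Unique.allFin⁺ n ; _≟_ = _≟ᶠ_ }

  ×-finite : ∀ {A B : Set} {{_ : Finite A}} {{_ : Finite B}} → Finite (A × B)
  ×-finite = record
    { elements = cartesianProduct elements elements
    ; complete = λ (a , b) → ∈-cartesianProduct⁺ (complete a) (complete b)
    ; unique   = Unique.cartesianProduct⁺ unique unique
    ; _≟_      = ≡-dec _≟_ _≟_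
    }

in∷-injective : ∀ {n k l} {I I′ : KSubset n k l} → (in∷ I) ≡ (in∷ I′) → I ≡ I′
in∷-injective refl = refl

out∷-injective : ∀ {n k l} {I I′ : KSubset n k l} → (out∷ I) ≡ (out∷ I′) → I ≡ I′
out∷-injective refl = refl

KSubset-≟ : ∀ {n k l} → DecidableEquality (KSubset n k l)
KSubset-≟ []       []        = yes refl
KSubset-≟ (in∷ I)  (in∷ I′)  = map′ (cong in∷_) in∷-injective (KSubset-≟ I I′)
KSubset-≟ (in∷ I)  (out∷ I′) = no λ ()
KSubset-≟ (out∷ I) (in∷ I′)  = no λ ()
KSubset-≟ (out∷ I) (out∷ I′) = map′ (cong out∷_) out∷-injective (KSubset-≟ I I′)

∈-allKSubsets : ∀ {n k l} (I : KSubset n k l) → I ∈ˡ allKSubsets n k l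
∈-allKSubsets []       = here refl
∈-allKSubsets (in∷ I)  = ∈-++⁺ˡ (∈-map⁺ in∷_ (∈-allKSubsets I))
∈-allKSubsets {suc n} {k} (out∷ I) = ∈-++⁺ʳ (startingIn n k _) (∈-map⁺ out∷_ (∈-allKSubsets I))

allKSubsets-unique : ∀ n k l → Unique (allKSubsets n k l)
startingIn-unique  : ∀ n k l → Unique (startingIn n k l)
startingOut-unique : ∀ n k l → Unique (startingOut n k l)
startings-disjoint : ∀ n k l {I} → ¬ (I ∈ˡ startingIn n k l × I ∈ˡ startingOut n k l)

allKSubsets-unique zero    zero    zero    = [] ∷ []
allKSubsets-unique zero    zero    (suc l) = []
allKSubsets-unique zero    (suc k) l       = []
allKSubsets-unique (suc n) k       l       =
  Unique.++⁺ (startingIn-unique n k l) (startingOut-unique n k l) (startings-disjoint n k l)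

startingIn-unique n zero    l = []
startingIn-unique n (suc k) l = Unique.map⁺ in∷-injective (allKSubsets-unique n k l)

startingOut-unique n k zero    = []
startingOut-unique n k (suc l) = Unique.map⁺ out∷-injective (allKSubsets-unique n k l)

startings-disjoint n (suc k) (suc l) (I∈in , I∈out) with ∈-map⁻ in∷_ I∈in | ∈-map⁻ out∷_ I∈out
... | _ , _ , refl | _ , _ , ()

-- Pascal's rule, applied to the subsets that contain the first element and those that avoid it. The
-- equation `n ≡ k + l` is assumed because the list is empty for any other `l`.
length-allKSubsets : ∀ n k l → n ≡ k ℕ.+ l → length (allKSubsets n k l) ≡ n C k
length-allKSubsets zero    zero    zero    _  = refl
length-allKSubsets (suc n) zero    (suc l) eq =
  trans (length-map out∷_ (allKSubsets n 0 l)) (length-allKSubsets n 0 l (ℕ.suc-injective eq))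
length-allKSubsets (suc n) (suc k) zero    eq with trans (ℕ.suc-injective eq) (ℕ.+-identityʳ k)
... | refl = trans (cong length (++-identityʳ (map in∷_ (allKSubsets n n 0))))
  (trans (length-map in∷_ (allKSubsets n n 0))
    (trans (length-allKSubsets n n 0 (sym (ℕ.+-identityʳ n))) (trans (nCn≡1 n) (sym (nCn≡1 (suc n))))))
length-allKSubsets (suc n) (suc k) (suc l) eq =
  trans (length-++ (map in∷_ (allKSubsets n k (suc l))))
    (trans (cong₂ ℕ._+_
        (trans (length-map in∷_ (allKSubsets n k (suc l))) (length-allKSubsets n k (suc l) (ℕ.suc-injective eq)))
        (trans (length-map out∷_ (allKSubsets n (suc k) l))
          (length-allKSubsets n (suc k) l (trans (ℕ.suc-injective eq) (ℕ.+-suc k l)))))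
      (nCk+nC[k+1]≡[n+1]C[k+1] n k))

instance
  KSubset-finite : ∀ {n k l} → Finite (KSubset n k l)
  KSubset-finite {n} {k} {l} = record
    { elements = allKSubsets n k l
    ; complete = ∈-allKSubsets
    ; unique   = allKSubsets-unique n k l
    ; _≟_      = KSubset-≟
    }

card : (A : Set) {{_ : Finite A}} → ℕ
card A = length (elements {A})

-- Coordinates and duality; translation between lists with `rk` and indexed families with
-- `LinearlyIndependent`, `InSpan` and `HasDimension`.

module Coordinates {c ℓ : Level} (ℝ : CompleteOrderedField c ℓ) where

  open CompleteOrderedField ℝ hiding (_≤_; refl; sym; trans; zero; _-_)
  open LinearAlgebra ℝ
  open import Algebra.Solver.Ring.NaturalCoefficients.Default commutativeSemiring
    using (solve; _:+_; _:*_; _:=_; con)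

  Σˡ : ∀ {A : Set} → List A → (A → Carrier) → Carrier
  Σˡ as f = foldr (λ a s → f a + s) 0# as

  module _ {A : Set} where

    Σˡ-cong : ∀ (as : List A) {f g : A → Carrier} → (∀ a → f a ≈ g a) → Σˡ as f ≈ Σˡ as g
    Σˡ-cong []       f≈g = ≈-refl
    Σˡ-cong (a ∷ as) f≈g = +-cong (f≈g a) (Σˡ-cong as f≈g)

    Σˡ-zero : ∀ (as : List A) {f : A → Carrier} → (∀ {a} → a ∈ˡ as → f a ≈ 0#) → Σˡ as f ≈ 0#
    Σˡ-zero []       f≈0 = ≈-refl
    Σˡ-zero (a ∷ as) f≈0 = ≈-trans (+-cong (f≈0 (here refl)) (Σˡ-zero as (f≈0 ∘ there))) (+-identityˡ 0#)

    Σˡ-axpy : ∀ (as : List A) t (f g : A → Carrier) → Σˡ as (axpy t f g) ≈ t * Σˡ as f + Σˡ as g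
    Σˡ-axpy []       t f g = ≈-sym (≈-trans (+-identityʳ _) (zeroʳ t))
    Σˡ-axpy (a ∷ as) t f g = ≈-trans (+-congˡ (Σˡ-axpy as t f g))
      (solve 5 (λ t x y u v → (t :* x :+ y) :+ (t :* u :+ v) := t :* (x :+ u) :+ (y :+ v)) ≈-refl
        t (f a) (g a) (Σˡ as f) (Σˡ as g))

    Σˡ-single : ∀ {as : List A} {a} {f : A → Carrier} → Unique as → a ∈ˡ as →
      (∀ {b} → b ≢ a → f b ≈ 0#) → Σˡ as f ≈ f a
    Σˡ-single {as = a ∷ as} {f = f} (a∉ ∷ _) (here refl) f≈0 = ≈-trans
      (+-congˡ (Σˡ-zero as λ b∈ → f≈0 λ { refl → All.lookup a∉ b∈ refl })) (+-identityʳ (f a))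
    Σˡ-single (b∉ ∷ un) (there a∈) f≈0 = ≈-trans
      (+-cong (f≈0 λ { refl → All.lookup b∉ a∈ refl }) (Σˡ-single un a∈ f≈0)) (+-identityˡ _)

    Σˡ-++ : ∀ (as bs : List A) (f : A → Carrier) → Σˡ (as ++ bs) f ≈ Σˡ as f + Σˡ bs f
    Σˡ-++ []       bs f = ≈-sym (+-identityˡ _)
    Σˡ-++ (a ∷ as) bs f = ≈-trans (+-congˡ (Σˡ-++ as bs f)) (≈-sym (+-assoc _ _ _))

  Σˡ-map : ∀ {A B : Set} (g : A → B) (as : List A) (f : B → Carrier) → Σˡ (map g as) f ≈ Σˡ as (f ∘ g)
  Σˡ-map g []       f = ≈-refl
  Σˡ-map g (a ∷ as) f = +-congˡ (Σˡ-map g as f)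

  Σˡ-product : ∀ {A B : Set} (as : List A) (bs : List B) (f : A × B → Carrier) →
    Σˡ (cartesianProduct as bs) f ≈ Σˡ as (λ a → Σˡ bs (λ b → f (a , b)))
  Σˡ-product []       bs f = ≈-refl
  Σˡ-product (a ∷ as) bs f = ≈-trans (Σˡ-++ (map (a ,_) bs) _ f)
    (+-cong (Σˡ-map (a ,_) bs f) (Σˡ-product as bs f))

  module _ {A : Set} {{_ : Finite A}} where

    unit : A → A → Carrier
    unit p q = if does (q ≟ p) then 1# else 0#

    unit-≡ : ∀ p → unit p p ≈ 1#
    unit-≡ p rewrite dec-true (p ≟ p) refl = ≈-refl

    unit-≢ : ∀ {p q} → q ≢ p → unit p q ≈ 0#
    unit-≢ {p} {q} q≢p rewrite dec-false (q ≟ p) q≢p = ≈-refl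

    dot : (A → Carrier) → (A → Carrier) → Carrier
    dot f x = Σˡ elements (λ a → f a * x a)

    dot-cong : ∀ f {x y : A → Carrier} → x ≐ y → dot f x ≈ dot f y
    dot-cong f x≐y = Σˡ-cong elements λ a → *-congˡ (x≐y a)

    dot-axpy : ∀ f t x y → dot f (axpy t x y) ≈ t * dot f x + dot f y
    dot-axpy f t x y = ≈-trans
      (Σˡ-cong elements λ a → solve 4 (λ f t x y → f :* (t :* x :+ y) := t :* (f :* x) :+ f :* y) ≈-refl
        (f a) t (x a) (y a))
      (Σˡ-axpy elements t (λ a → f a * x a) (λ a → f a * y a))

    dot-unit : ∀ f p → dot f (unit p) ≈ f p
    dot-unit f p = ≈-trans
      (Σˡ-single {f = λ a → f a * unit p a} unique (complete p) λ {b} b≢p → ≈-trans (*-congˡ (unit-≢ b≢p)) (zeroʳ (f b)))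
      (≈-trans (*-congˡ (unit-≡ p)) (*-identityʳ (f p)))

    dot-span : ∀ f {L v} → (∀ {x} → x ∈ˡ L → dot f x ≈ 0#) → Span L v → dot f v ≈ 0#
    dot-span f L≈0 (nil v≐𝟘) = ≈-trans (dot-cong f v≐𝟘) (Σˡ-zero elements λ {a} _ → zeroʳ (f a))
    dot-span f L≈0 (step t {x} {y} x∈L y∈ v≐) = ≈-trans (dot-cong f v≐) (≈-trans (dot-axpy f t x y)
      (≈-trans (+-cong (≈-trans (*-congˡ (L≈0 x∈L)) (zeroʳ t)) (dot-span f L≈0 y∈)) (+-identityˡ 0#)))

    expansion : List A → (A → Carrier) → A → Carrier
    expansion ps x = foldr (λ p → axpy (x p) (unit p)) 𝟘 ps

    expansion-at : ∀ ps x a → expansion ps x a ≈ Σˡ ps (λ p → x p * unit p a)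
    expansion-at []       x a = ≈-refl
    expansion-at (p ∷ ps) x a = +-congˡ (expansion-at ps x a)

    expansion-elements : ∀ x → expansion elements x ≐ x
    expansion-elements x a = ≈-trans (expansion-at elements x a) (≈-trans
      (Σˡ-single {f = λ p → x p * unit p a} unique (complete a)
        λ {b} b≢a → ≈-trans (*-congˡ (unit-≢ (b≢a ∘ sym))) (zeroʳ (x b)))
      (≈-trans (*-congˡ (unit-≡ a)) (*-identityʳ (x a))))

    expansion-linear : ∀ {B : Set} {φ : (A → Carrier) → B → Carrier} → IsLinear φ → ∀ ps x b →
      φ (expansion ps x) b ≈ Σˡ ps (λ p → φ (unit p) b * x p)
    expansion-linear lin []       x b = φ-𝟘 lin b
    expansion-linear {φ = φ} lin (p ∷ ps) x b = ≈-trans (φ-axpy lin (x p) (unit p) (expansion ps x) b)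
      (+-cong (*-comm (x p) (φ (unit p) b)) (expansion-linear lin ps x b))

    -- Turns a coordinate of a quotient map into a vector orthogonal to the generators.
    linear-as-dot : ∀ {B : Set} {φ : (A → Carrier) → B → Carrier} → IsLinear φ → ∀ x b →
      φ x b ≈ dot (λ p → φ (unit p) b) x
    linear-as-dot lin x b = ≈-trans (φ-cong lin (λ a → ≈-sym (expansion-elements x a)) b)
      (expansion-linear lin elements x b)

    span-by-units : ∀ {L} → (∀ p → Span L (unit p)) → ∀ x → Span L x
    span-by-units {L} units x = span-cong (expansion-elements x) (go elements)
      where
      go : ∀ ps → Span L (expansion ps x)
      go []       = nil λ _ → ≈-refl
      go (p ∷ ps) = span-axpy (x p) (units p) (go ps)

    -- At coordinate `p` every listed vector other than `x p` vanishes, hence so does every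
    -- combination of them.
    rk-diagonal : ∀ {x : A → A → Carrier} {ps} → Unique ps → (∀ {p} → p ∈ˡ ps → ¬ (x p p ≈ 0#)) →
      (∀ {p q} → p ∈ˡ ps → q ∈ˡ ps → q ≢ p → x p q ≈ 0#) → length ps ≤ rk (map x ps)
    rk-diagonal {x} {ps} un diag off = ℕ.≤-trans (ℕ.m≤m+n (length ps) (rk {A} [])) (ℕ.≤-trans
      (rk-irredundant un λ {p} {js} p∈ js⊆ xp∈ → diag p∈ (span-vanish p
        (λ v∈ → vanish p∈ js⊆ (∈-++⁻ (map x js) v∈)) xp∈))
      (rk-mono (++-⊑ span-member λ ())))
      where
      vanish : ∀ {p js v} → p ∈ˡ ps → (∀ {j} → j ∈ˡ js → j ∈ˡ ps × j ≢ p) → v ∈ˡ map x js ⊎ v ∈ˡ [] → v p ≈ 0#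
      vanish {p} {js} p∈ js⊆ (inj₁ v∈) with ∈-map⁻ x {xs = js} v∈
      ... | j , j∈ , refl = let j∈ps , j≢p = js⊆ j∈ in off j∈ps p∈ (j≢p ∘ sym)

    spanning⇒rk : ∀ {L} → (∀ x → Span L x) → card A ≤ rk L
    spanning⇒rk spans = ℕ.≤-trans
      (rk-diagonal {x = unit} unique (λ {p} _ unit≈0 → 0≉1 (≈-trans (≈-sym unit≈0) (unit-≡ p))) (λ _ _ → unit-≢))
      (rk-mono λ {x} _ → spans x)

    -- The `card A` unit vectors span `L`, and by `rk-spanning` equal rank turns this inclusion
    -- around.
    rk⇒spanning : ∀ {L} → card A ≤ rk L → ∀ x → Span L x
    rk⇒spanning {L} full = span-by-units λ p → rk-spanning {M = L} {map unit elements}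
      (λ {x} _ → span-by-units (λ q → span-member (∈-map⁺ unit (complete q))) x)
      (ℕ.≤-trans (rk≤length (map unit elements)) (ℕ.≤-trans (ℕ.≤-reflexive (length-map unit elements)) full))
      (∈-map⁺ unit (complete p))

    -- If some `unit p` escapes the span, some coordinate `q` of a quotient map is nonzero on it,
    -- and `f` is that coordinate written as a scalar product. For the rows of a framework `f` will
    -- be a nonzero motion.
    spanning-or-annihilated : ∀ L → (∀ x → Span L x) ⊎
      ∃ λ f → (∀ {x} → x ∈ˡ L → dot f x ≈ 0#) × ∃ λ p → ¬ (f p ≈ 0#)
    spanning-or-annihilated L with Any.any? (λ p → ¬? (span? L (unit p))) elements
    ... | no all∈ = inj₁ (span-by-units λ p → decidable-stable (span? L (unit p)) λ p∉ → all∈ (lose (complete p) p∉))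
    ... | yes some with find some
    ...   | p , _ , p∉ with quotient L
    ...     | record { N = N ; linear = linear ; kills = kills ; exact = exact } with nonzero? (N (unit p))
    ...       | inj₁ N≐𝟘 = ⊥-elim (p∉ (exact N≐𝟘))
    ...       | inj₂ (q , Nq≉0) = inj₂
      ((λ r → N (unit r) q) , (λ {x} x∈ → ≈-trans (≈-sym (linear-as-dot linear x q)) (kills x∈ q)) , p , Nq≉0)

  module _ {A : Set} where

    private
      comb : ∀ {n} → Subset n → (Fin n → Carrier) → (Fin n → A → Carrier) → A → Carrier
      comb = combination ℝ

    combination-∈ : ∀ {n} (S : Subset n) t (x : Fin n → A → Carrier) {L} →
      (∀ {i} → i ∈ S → t i ≈ 0# ⊎ Span L (x i)) → Span L (combination ℝ S t x)
    combination-∈ []            t x h = nil λ _ → ≈-refl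
    combination-∈ (outside ∷ S) t x h = span-cong (λ a → ≈-sym (+-identityˡ _))
      (combination-∈ S (t ∘ suc) (x ∘ suc) (h ∘ there))
    combination-∈ (inside ∷ S)  t x h with h here | combination-∈ S (t ∘ suc) (x ∘ suc) (h ∘ there)
    ... | inj₁ t≈0 | rest = span-cong
      (λ a → ≈-sym (≈-trans (+-congʳ (≈-trans (*-congʳ t≈0) (zeroˡ (x zero a)))) (+-identityˡ _))) rest
    ... | inj₂ x∈  | rest = span-axpy (t zero) x∈ rest

    combination-axpy : ∀ {n} (S : Subset n) s t t′ (x : Fin n → A → Carrier) →
      combination ℝ S (axpy s t t′) x ≐ axpy s (combination ℝ S t x) (combination ℝ S t′ x)
    combination-axpy []            s t t′ x a = ≈-sym (≈-trans (+-identityʳ _) (zeroʳ s))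
    combination-axpy (outside ∷ S) s t t′ x a = ≈-trans (+-congˡ (combination-axpy S s (t ∘ suc) (t′ ∘ suc) (x ∘ suc) a))
      (solve 3 (λ s u v → con 0 :+ (s :* u :+ v) := s :* (con 0 :+ u) :+ (con 0 :+ v)) ≈-refl
        s (comb S (t ∘ suc) (x ∘ suc) a) (comb S (t′ ∘ suc) (x ∘ suc) a))
    combination-axpy (inside ∷ S)  s t t′ x a = ≈-trans (+-congˡ (combination-axpy S s (t ∘ suc) (t′ ∘ suc) (x ∘ suc) a))
      (solve 6 (λ s p q y u v → (s :* p :+ q) :* y :+ (s :* u :+ v) := s :* (p :* y :+ u) :+ (q :* y :+ v)) ≈-refl
        s (t zero) (t′ zero) (x zero a) (comb S (t ∘ suc) (x ∘ suc) a) (comb S (t′ ∘ suc) (x ∘ suc) a))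

    combination-zero : ∀ {n} (S : Subset n) {t} (x : Fin n → A → Carrier) → (∀ i → t i ≈ 0#) → combination ℝ S t x ≐ 𝟘
    combination-zero S x t≈0 = span-[] (combination-∈ S _ x λ {i} _ → inj₁ (t≈0 i))

    combination-unit : ∀ {n} {S : Subset n} {i} → i ∈ S → ∀ (x : Fin n → A → Carrier) →
      combination ℝ S (unit i) x ≐ x i
    combination-unit {S = _ ∷ S} here x a = ≈-trans
      (+-cong (*-identityˡ (x zero a)) (combination-zero S (x ∘ suc) (λ _ → ≈-refl) a)) (+-identityʳ (x zero a))
    combination-unit {S = inside ∷ S} (there i∈S) x a = ≈-trans
      (+-cong (zeroˡ (x zero a)) (combination-unit i∈S (x ∘ suc) a)) (+-identityˡ _)
    combination-unit {S = outside ∷ S} (there i∈S) x a = ≈-trans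
      (+-congˡ (combination-unit i∈S (x ∘ suc) a)) (+-identityˡ _)

    -- The coefficients are indexed by `S` but vanish off `T`; with `S - i` for `T` the entry at `i`
    -- is known to be zero.
    span⇒combination : ∀ {n} (S T : Subset n) (x : Fin n → A → Carrier) {y} → T ⊆ S → Span (map x (members T)) y →
      ∃ λ t → (∀ {j} → j ∉ T → t j ≈ 0#) × combination ℝ S t x ≐ y
    span⇒combination S T x T⊆S (nil y≐𝟘) =
      𝟘 , (λ _ → ≈-refl) , λ a → ≈-trans (combination-zero S x (λ _ → ≈-refl) a) (≈-sym (y≐𝟘 a))
    span⇒combination S T x T⊆S (step s v∈ z∈ y≐) with ∈-map⁻ x {xs = members T} v∈
    ... | i , i∈ , refl =
      let t , off , comb≐ = span⇒combination S T x T⊆S z∈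
          i∈T = ∈-members⁻ {S = T} i∈
      in axpy s (unit i) t ,
         (λ {j} j∉ → ≈-trans (+-cong (≈-trans (*-congˡ (unit-≢ {p = i} {j} λ { refl → j∉ i∈T })) (zeroʳ s)) (off j∉)) (+-identityˡ 0#)) ,
         λ a → ≈-trans (combination-axpy S s (unit i) t x a)
           (≈-trans (+-cong (*-congˡ (combination-unit (T⊆S i∈T) x a)) (comb≐ a)) (≈-sym (y≐ a)))

    inSpan⇒span : ∀ {n} (S : Subset n) {x : Fin n → A → Carrier} {y} → InSpan ℝ S x y → Span (map x (members S)) y
    inSpan⇒span S {x} (t , eq) = span-cong eq
      (combination-∈ S t x λ i∈S → inj₂ (span-member (∈-map⁺ x (∈-members⁺ i∈S))))

    span⇒inSpan : ∀ {n} (S : Subset n) {x : Fin n → A → Carrier} {y} → Span (map x (members S)) y → InSpan ℝ S x y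
    span⇒inSpan S {x} y∈ = let t , _ , eq = span⇒combination S S x id y∈ in t , eq

    module _ {{_ : Finite A}} where

      independent⇒rk : ∀ {n} {S : Subset n} {x : Fin n → A → Carrier} →
        LinearlyIndependent ℝ S x → ∣ S ∣ ≤ rk (map x (members S))
      independent⇒rk {S = S} {x} ind = subst (_≤ rk (map x (members S))) (length-members S)
        (ℕ.≤-trans (ℕ.m≤m+n _ (rk {A} [])) (ℕ.≤-trans
          (rk-irredundant (members-unique S) irredundant) (rk-mono (++-⊑ span-member λ ()))))
        where
        irredundant : ∀ {i js} → i ∈ˡ members S → (∀ {j} → j ∈ˡ js → j ∈ˡ members S × j ≢ i) →
          ¬ Span (map x js ++ []) (x i)
        irredundant {i} {js} i∈ js⊆ xi∈ =
          let t , off , eq = span⇒combination S (S - i) x (p─q⊆p S ⁅ i ⁆) (span-trans (++-⊑ others λ ()) xi∈)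
              ti≈0 = off λ i∈S-i → x∈p─q⇒x∉q {p = S} i∈S-i (x∈⁅x⁆ i)
              i∈S = ∈-members⁻ {S = S} i∈
              -- The coefficients `unit i - t` give a relation whose entry at `i` is 1, because
              -- `t i` vanishes.
              relation = λ a → ≈-trans (combination-axpy S (- 1#) t (unit i) x a)
                (≈-trans (+-cong (*-congˡ (eq a)) (combination-unit i∈S x a))
                (≈-trans (+-congˡ (≈-sym (*-identityˡ (x i a))))
                (≈-trans (≈-sym (distribʳ (x i a) (- 1#) 1#))
                (≈-trans (*-congʳ (-‿inverseˡ 1#)) (zeroˡ (x i a))))))
          in 0≉1 (≈-sym (≈-trans (≈-sym (≈-trans (+-cong (≈-trans (*-congˡ ti≈0) (zeroʳ (- 1#))) (unit-≡ i))
               (+-identityˡ 1#))) (ind _ relation i i∈S)))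
          where
          others : map x js ⊑ map x (members (S - i))
          others v∈ with ∈-map⁻ x v∈
          ... | j , j∈ , refl = let j∈S , j≢i = js⊆ j∈ in
            span-member (∈-map⁺ x (∈-members⁺ (x∈p∧x≢y⇒x∈p-y (∈-members⁻ {S = S} j∈S) j≢i)))

      rk⇒independent : ∀ {n} {S : Subset n} {x : Fin n → A → Carrier} →
        ∣ S ∣ ≤ rk (map x (members S)) → LinearlyIndependent ℝ S x
      rk⇒independent {S = S} {x} full t eq i i∈S = decidable-stable (t i ≈? 0#) λ ti≉0 → ℕ.<⇒≱ (begin-strict
        rk (map x (members S))             ≤⟨ rk-mono (λ v∈ → rest ti≉0 (∈-map⁻ x v∈)) ⟩
        rk (map x (members (S - i)))       ≤⟨ rk≤length (map x (members (S - i))) ⟩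
        length (map x (members (S - i)))   ≡⟨ length-map x (members (S - i)) ⟩
        length (members (S - i))           ≡⟨ length-members (S - i) ⟩
        ∣ S - i ∣                          <⟨ x∈p⇒∣p-x∣<∣p∣ i∈S ⟩
        ∣ S ∣                              ∎) full
        where
        open ℕ.≤-Reasoning
        open import Algebra.Properties.Ring ring using (-‿distribˡ-*)
        L = map x (members (S - i))
        other : ∀ {j} → j ∈ S → j ≢ i → Span L (x j)
        other j∈S j≢i = span-member (∈-map⁺ x (∈-members⁺ (x∈p∧x≢y⇒x∈p-y j∈S j≢i)))
        removed : ¬ (t i ≈ 0#) → Span L (x i)
        removed ti≉0 = span-cong
          (λ a → ≈-trans (combination-axpy S s t (unit i) x a)
            (≈-trans (+-cong (≈-trans (*-congˡ (eq a)) (zeroʳ s)) (combination-unit i∈S x a)) (+-identityˡ (x i a))))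
          (combination-∈ S (axpy s t (unit i)) x coefficient)
          where
          -- With this factor `s t + unit i` has entry 0 at `i`, while its combination is still
          -- `x i`.
          s = - (t i ⁻¹)
          coefficient : ∀ {j} → j ∈ S → axpy s t (unit i) j ≈ 0# ⊎ Span L (x j)
          coefficient {j} j∈S with j ≟ᶠ i
          ... | no j≢i   = inj₂ (other j∈S j≢i)
          ... | yes refl = inj₁ (≈-trans (+-congʳ (≈-trans (≈-sym (-‿distribˡ-* (t i ⁻¹) (t i)))
            (-‿cong (≈-trans (*-comm (t i ⁻¹) (t i)) (inverseʳ (t i) ti≉0))))) (-‿inverseˡ 1#))
        rest : ¬ (t i ≈ 0#) → ∀ {v} → (∃ λ j → j ∈ˡ members S × v ≡ x j) → Span L v
        rest ti≉0 (j , j∈ , refl) with j ≟ᶠ i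
        ... | yes refl = removed ti≉0
        ... | no j≢i   = other (∈-members⁻ {S = S} j∈) j≢i

      dimension⇒rk : ∀ {n} {S : Subset n} {x : Fin n → A → Carrier} {k} →
        HasDimension ℝ (InSpan ℝ S x) k → k ≤ rk (map x (members S))
      dimension⇒rk {S = S} {x} {k} (y , y∈ , ind , _) = begin
        k                           ≡⟨ ∣⊤∣≡n k ⟨
        ∣ ⊤ {k} ∣                   ≤⟨ independent⇒rk ind ⟩
        rk (map y (members ⊤))      ≤⟨ rk-mono (λ v∈ → within (∈-map⁻ y v∈)) ⟩
        rk (map x (members S))      ∎
        where
        open ℕ.≤-Reasoning
        within : ∀ {v} → (∃ λ j → j ∈ˡ members ⊤ × v ≡ y j) → Span (map x (members S)) v
        within (j , _ , refl) = inSpan⇒span S (y∈ j)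

      -- The greedy basis supplies the dimension witness that condition (2) asks for.
      span-dimension : ∀ {n} (S : Subset n) (x : Fin n → A → Carrier) →
        HasDimension ℝ (InSpan ℝ S x) (length (basis (map x (members S))))
      span-dimension S x = y , (λ j → span⇒inSpan S (span-member (basis⊆ L (∈-lookup j)))) ,
        rk⇒independent (begin
          ∣ ⊤ {length B} ∣            ≡⟨ ∣⊤∣≡n (length B) ⟩
          length B                    ≡⟨ length-basis L ⟩
          rk L                        ≤⟨ rk-mono (λ v∈ → span-trans B⊑ (basis-spans L v∈)) ⟩
          rk (map y (members ⊤))      ∎) ,
        λ w w∈ → span⇒inSpan ⊤ (span-trans (λ v∈ → span-trans B⊑ (basis-spans L v∈)) (inSpan⇒span S w∈))
        where
        open ℕ.≤-Reasoning
        L = map x (members S)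
        B = basis L
        y = List.lookup B
        B⊑ : B ⊑ map y (members ⊤)
        B⊑ v∈ = subst (Span _) (sym (Any.lookup-index v∈)) (span-member (∈-map⁺ y (∈-members⁺ {S = ⊤} {Any.index v∈} ∈⊤)))

-- Membership in comprehensions, and in the vertex and boundary sets of a graph.

module _ {n : ℕ} {p} {P : Fin n → Set p} (P? : ∀ i → Dec (P i)) where

  -- `V⟨_⟩` and `R-at` unfold to this form, so the two membership rules below serve for them as
  -- well.
  comprehension : Subset n
  comprehension = tabulate (λ i → does (P? i))

  ∈-comprehension⁺ : ∀ {i} → P i → i ∈ comprehension
  ∈-comprehension⁺ {i} Pi = lookup⇒[]= i comprehension
    (trans (lookup∘tabulate (λ i → does (P? i)) i) (dec-true (P? i) Pi))

  ∈-comprehension⁻ : ∀ {i} → i ∈ comprehension → P i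
  ∈-comprehension⁻ {i} i∈ with P? i | trans (sym (lookup∘tabulate (λ i → does (P? i)) i)) ([]=⇒lookup i∈)
  ... | yes Pi | _ = Pi

module _ (G : Graph) where

  open Graph G

  private
    incident? : ∀ F v → Dec (∃ λ e → e ∈ F × (end₁ e ≡ v ⊎ end₂ e ≡ v))
    incident? F v = any? λ e → (e ∈? F) ×-dec ((end₁ e ≟ᶠ v) ⊎-dec (end₂ e ≟ᶠ v))

  ∈-V⟨⟩⁺ : ∀ {F e v} → e ∈ F → end₁ e ≡ v ⊎ end₂ e ≡ v → v ∈ V⟨ F ⟩
  ∈-V⟨⟩⁺ {F} e∈F end = ∈-comprehension⁺ (incident? F) (_ , e∈F , end)

  ∈-V⟨⟩⁻ : ∀ {F v} → v ∈ V⟨ F ⟩ → ∃ λ e → e ∈ F × (end₁ e ≡ v ⊎ end₂ e ≡ v)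
  ∈-V⟨⟩⁻ {F} = ∈-comprehension⁻ (incident? F)

  module _ {ρ} {R : Fin ρ → V} where

    ∈-R-at⁺ : ∀ {v r} → R r ≡ v → r ∈ R-at R v
    ∈-R-at⁺ {v} = ∈-comprehension⁺ (λ r → R r ≟ᶠ v)

    ∈-R-at⁻ : ∀ {v r} → r ∈ R-at R v → R r ≡ v
    ∈-R-at⁻ {v} = ∈-comprehension⁻ (λ r → R r ≟ᶠ v)

    ∈-R-on⁺ : ∀ {F r} → R r ∈ V⟨ F ⟩ → r ∈ R-on R F
    ∈-R-on⁺ {F} {r} Rr∈ = lookup⇒[]= r (R-on R F)
      (trans (lookup∘tabulate (λ r → lookup V⟨ F ⟩ (R r)) r) ([]=⇒lookup Rr∈))

    ∈-R-on⁻ : ∀ {F r} → r ∈ R-on R F → R r ∈ V⟨ F ⟩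
    ∈-R-on⁻ {F} {r} r∈ = lookup⇒[]= (R r) V⟨ F ⟩
      (trans (sym (lookup∘tabulate (λ r → lookup V⟨ F ⟩ (R r)) r)) ([]=⇒lookup r∈))

-- Vectors attached to vertices, as in the rows of a rigidity matrix.

module Incidence {c ℓ : Level} (ℝ : CompleteOrderedField c ℓ) where

  open CompleteOrderedField ℝ hiding (_≤_; refl; sym; trans; zero; _-_)
  open LinearAlgebra ℝ
  open Coordinates ℝ
  open import Algebra.Solver.Ring.NaturalCoefficients.Default commutativeSemiring
    using (solve; _:+_; _:*_; _:=_; con)
  open import Algebra.Properties.Ring ring using (-1*x≈-x; -‿involutive)

  -1*-1≈1 : - 1# * - 1# ≈ 1#
  -1*-1≈1 = ≈-trans (-1*x≈-x (- 1#)) (-‿involutive 1#)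

  -1*x≈0⇒x≈0 : ∀ {x} → - 1# * x ≈ 0# → x ≈ 0#
  -1*x≈0⇒x≈0 {x} -x≈0 = ≈-trans (≈-sym (≈-trans (*-congʳ -1*-1≈1) (*-identityˡ x)))
    (≈-trans (*-assoc (- 1#) (- 1#) x) (≈-trans (*-congˡ -x≈0) (zeroʳ (- 1#))))

  module _ {m : ℕ} {K : Set} where

    -- The tensor `δ_v ⊗ y`: the row of a boundary bar at `v`.
    single : Fin m → (K → Carrier) → Fin m × K → Carrier
    single v y (w , J) = if does (w ≟ᶠ v) then y J else 0#

    single-≡ : ∀ v y J → single v y (v , J) ≈ y J
    single-≡ v y J rewrite dec-true (v ≟ᶠ v) refl = ≈-refl

    single-≢ : ∀ {v w} y J → w ≢ v → single v y (w , J) ≈ 0#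
    single-≢ {v} {w} y J w≢v rewrite dec-false (w ≟ᶠ v) w≢v = ≈-refl

    single-linear : ∀ v → IsLinear (single v)
    single-linear v = record
      { φ-cong = λ x≐y (w , J) → if-cong w (x≐y J)
      ; φ-𝟘    = λ (w , J) → if-zero w
      ; φ-axpy = λ t x y (w , J) → if-axpy w t (x J) (y J)
      }
      where
      if-cong : ∀ w {a b} → a ≈ b → (if does (w ≟ᶠ v) then a else 0#) ≈ (if does (w ≟ᶠ v) then b else 0#)
      if-cong w a≈b with does (w ≟ᶠ v)
      ... | true  = a≈b
      ... | false = ≈-refl
      if-zero : ∀ w → (if does (w ≟ᶠ v) then 0# else 0#) ≈ 0#
      if-zero w with does (w ≟ᶠ v)
      ... | true  = ≈-refl
      ... | false = ≈-refl
      if-axpy : ∀ w t a b → (if does (w ≟ᶠ v) then t * a + b else 0#) ≈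
        t * (if does (w ≟ᶠ v) then a else 0#) + (if does (w ≟ᶠ v) then b else 0#)
      if-axpy w t a b with does (w ≟ᶠ v)
      ... | true  = ≈-refl
      ... | false = ≈-sym (≈-trans (+-identityʳ _) (zeroʳ t))

    -- The tensor `(δ_v − δ_w) ⊗ y`: the row of an edge from `v` to `w`, which is zero for a loop.
    diff : Fin m → Fin m → (K → Carrier) → Fin m × K → Carrier
    diff v w y = axpy (- 1#) (single w y) (single v y)

    diff-linear : ∀ v w → IsLinear (diff v w)
    diff-linear v w = record
      { φ-cong = λ x≐y p → +-cong (*-congˡ (φ-cong (single-linear w) x≐y p)) (φ-cong (single-linear v) x≐y p)
      ; φ-𝟘    = λ p → ≈-trans (+-cong (≈-trans (*-congˡ (φ-𝟘 (single-linear w) p)) (zeroʳ _)) (φ-𝟘 (single-linear v) p))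
                         (+-identityˡ 0#)
      ; φ-axpy = λ t x y p → ≈-trans
          (+-cong (*-congˡ (φ-axpy (single-linear w) t x y p)) (φ-axpy (single-linear v) t x y p))
          (solve 6 (λ n t a b e f → n :* (t :* a :+ b) :+ (t :* e :+ f) := t :* (n :* a :+ e) :+ (n :* b :+ f)) ≈-refl
            (- 1#) t (single w x p) (single w y p) (single v x p) (single v y p))
      }

    diff-self : ∀ v y → diff v v y ≐ 𝟘
    diff-self v y p = ≈-trans (+-congʳ (-1*x≈-x _)) (-‿inverseˡ _)

    diff-outside : ∀ {u v w} y J → u ≢ v → u ≢ w → diff v w y (u , J) ≈ 0#
    diff-outside y J u≢v u≢w = ≈-trans
      (+-cong (≈-trans (*-congˡ (single-≢ y J u≢w)) (zeroʳ _)) (single-≢ y J u≢v)) (+-identityˡ 0#)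

    diff-head : ∀ {v w} y J → v ≢ w → diff v w y (v , J) ≈ y J
    diff-head {v} y J v≢w = ≈-trans
      (+-cong (≈-trans (*-congˡ (single-≢ y J v≢w)) (zeroʳ _)) (single-≡ v y J)) (+-identityˡ (y J))

    diff-tail : ∀ {v w} y J → w ≢ v → diff v w y (w , J) ≈ - 1# * y J
    diff-tail {w = w} y J w≢v = ≈-trans
      (+-cong (*-congˡ (single-≡ w y J)) (single-≢ y J w≢v)) (+-identityʳ _)

    diff-trans : ∀ u v w y → diff u w y ≐ axpy 1# (diff u v y) (diff v w y)
    diff-trans u v w y p = ≈-sym (begin
      1# * (- 1# * single v y p + single u y p) + (- 1# * single w y p + single v y p)
        ≈⟨ solve 4 (λ n u v w → con 1 :* (n :* v :+ u) :+ (n :* w :+ v) := (n :+ con 1) :* v :+ (n :* w :+ u)) ≈-refl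
             (- 1#) (single u y p) (single v y p) (single w y p) ⟩
      (- 1# + 1#) * single v y p + diff u w y p
        ≈⟨ +-congʳ (≈-trans (*-congʳ (-‿inverseˡ 1#)) (zeroˡ _)) ⟩
      0# + diff u w y p                                ≈⟨ +-identityˡ _ ⟩
      diff u w y p                                     ∎)
      where open import Relation.Binary.Reasoning.Setoid setoid

    diff-swap : ∀ u v y → diff u v y ≐ axpy (- 1#) (diff v u y) 𝟘
    diff-swap u v y p = ≈-sym (begin
      - 1# * (- 1# * single u y p + single v y p) + 0#
        ≈⟨ solve 3 (λ n u v → n :* (n :* u :+ v) :+ con 0 := n :* v :+ (n :* n) :* u) ≈-refl
             (- 1#) (single u y p) (single v y p) ⟩
      - 1# * single v y p + - 1# * - 1# * single u y p  ≈⟨ +-congˡ (≈-trans (*-congʳ -1*-1≈1) (*-identityˡ _)) ⟩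
      diff u v y p                                      ∎)
      where open import Relation.Binary.Reasoning.Setoid setoid

    span-diff-trans : ∀ {L} u v w y → Span L (diff u v y) → Span L (diff v w y) → Span L (diff u w y)
    span-diff-trans u v w y uv vw = span-cong (λ p → ≈-sym (diff-trans u v w y p)) (span-axpy 1# uv vw)

    span-diff-swap : ∀ {L} u v y → Span L (diff v u y) → Span L (diff u v y)
    span-diff-swap u v y vu = span-cong (λ p → ≈-sym (diff-swap u v y p)) (span-axpy (- 1#) vu (nil λ _ → ≈-refl))

    span-single : ∀ {L} v w y → Span L (diff v w y) → Span L (single w y) → Span L (single v y)
    span-single v w y vw w∈ = span-cong
      (λ p → begin
        1# * (- 1# * single w y p + single v y p) + single w y p
          ≈⟨ solve 3 (λ n v w → con 1 :* (n :* w :+ v) :+ w := (n :+ con 1) :* w :+ v) ≈-refl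
               (- 1#) (single v y p) (single w y p) ⟩
        (- 1# + 1#) * single w y p + single v y p
          ≈⟨ +-congʳ (≈-trans (*-congʳ (-‿inverseˡ 1#)) (zeroˡ _)) ⟩
        0# + single v y p  ≈⟨ +-identityˡ _ ⟩
        single v y p       ∎)
      (span-axpy 1# vw w∈)
      where open import Relation.Binary.Reasoning.Setoid setoid

    -- Kills all differences and recovers `y` from `single v y`; this separates the boundary rows
    -- from the edge candidates.
    total : (Fin m × K → Carrier) → K → Carrier
    total x J = Σˡ (allFin m) (λ v → x (v , J))

    total-linear : IsLinear total
    total-linear = record
      { φ-cong = λ x≐y J → Σˡ-cong (allFin m) λ v → x≐y (v , J)
      ; φ-𝟘    = λ J → Σˡ-zero (allFin m) λ _ → ≈-refl
      ; φ-axpy = λ t x y J → Σˡ-axpy (allFin m) t (λ v → x (v , J)) (λ v → y (v , J))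
      }

    total-single : ∀ v y → total (single v y) ≐ y
    total-single v y J = ≈-trans
      (Σˡ-single {f = λ w → single v y (w , J)} (Unique.allFin⁺ m) (∈-allFin v) (single-≢ y J)) (single-≡ v y J)

    total-diff : ∀ v w y → total (diff v w y) ≐ 𝟘
    total-diff v w y J = ≈-trans (φ-axpy total-linear (- 1#) (single w y) (single v y) J)
      (≈-trans (+-cong (≈-trans (*-congˡ (total-single w y J)) (-1*x≈-x (y J))) (total-single v y J)) (-‿inverseˡ (y J)))

    -- The projection that fixes vectors supported on `X` and kills those supported off it; it
    -- splits ranks along components.
    restrict : Subset m → (Fin m × K → Carrier) → Fin m × K → Carrier
    restrict X x p = if does (proj₁ p ∈? X) then x p else 0#

    restrict-linear : ∀ X → IsLinear (restrict X)
    restrict-linear X = record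
      { φ-cong = λ x≐y p → if-cong p (x≐y p)
      ; φ-𝟘    = if-zero
      ; φ-axpy = λ t x y p → if-axpy p t (x p) (y p)
      }
      where
      if-cong : ∀ p {a b} → a ≈ b → (if does (proj₁ p ∈? X) then a else 0#) ≈ (if does (proj₁ p ∈? X) then b else 0#)
      if-cong p a≈b with does (proj₁ p ∈? X)
      ... | true  = a≈b
      ... | false = ≈-refl
      if-zero : ∀ (p : Fin m × K) → (if does (proj₁ p ∈? X) then 0# else 0#) ≈ 0#
      if-zero p with does (proj₁ p ∈? X)
      ... | true  = ≈-refl
      ... | false = ≈-refl
      if-axpy : ∀ p t a b → (if does (proj₁ p ∈? X) then t * a + b else 0#) ≈
        t * (if does (proj₁ p ∈? X) then a else 0#) + (if does (proj₁ p ∈? X) then b else 0#)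
      if-axpy p t a b with does (proj₁ p ∈? X)
      ... | true  = ≈-refl
      ... | false = ≈-sym (≈-trans (+-identityʳ _) (zeroʳ t))

    SupportedOn : Subset m → (Fin m × K → Carrier) → Set ℓ
    SupportedOn X x = ∀ {v} J → v ∉ X → x (v , J) ≈ 0#

    restrict-supported : ∀ {X x} → SupportedOn X x → x ≐ restrict X x
    restrict-supported {X} supp (v , J) with v ∈? X
    ... | yes _  = ≈-refl
    ... | no v∉X = supp J v∉X

    restrict-disjoint : ∀ {X Y x} → SupportedOn Y x → (∀ {v} → v ∈ X → v ∉ Y) → restrict X x ≐ 𝟘
    restrict-disjoint {X} supp dis (v , J) with v ∈? X
    ... | yes v∈X = supp J (dis v∈X)
    ... | no _    = ≈-refl

    single-supported : ∀ {X v} y → v ∈ X → SupportedOn X (single v y)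
    single-supported y v∈X {w} J w∉X = single-≢ {w = w} y J λ { refl → w∉X v∈X }

    diff-supported : ∀ {X v w} y → v ∈ X → w ∈ X → SupportedOn X (diff v w y)
    diff-supported y v∈X w∈X {u} J u∉X = diff-outside {u} y J (λ { refl → u∉X v∈X }) (λ { refl → u∉X w∈X })

-- From sparsity to the rank of the candidates together with the boundary rows.

length-cartesianProduct : ∀ {A B : Set} (as : List A) (bs : List B) →
  length (cartesianProduct as bs) ≡ length as ℕ.* length bs
length-cartesianProduct []       bs = refl
length-cartesianProduct (a ∷ as) bs = trans (length-++ (map (a ,_) bs))
  (cong₂ ℕ._+_ (length-map (a ,_) bs) (length-cartesianProduct as bs))

∣∣-cover : ∀ {n} {S T U : Subset n} → (∀ {i} → i ∈ S → i ∈ T ⊎ i ∈ U) → ∣ S ∣ ≤ ∣ T ∣ ℕ.+ ∣ U ∣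
∣∣-cover {T = T} {U} cover = ℕ.≤-trans (p⊆q⇒∣p∣≤∣q∣ (λ i∈S → x∈p∪q⁺ (cover i∈S))) (∣∪∣≤ T U)

module Sparse {c ℓ : Level} (ℝ : CompleteOrderedField c ℓ) {K : Set} {{finiteK : Finite K}} (J₀ : K)
  (G : Graph) {ρ : ℕ} (R : Fin ρ → Graph.V G) where

  open CompleteOrderedField ℝ hiding (_≤_; refl; sym; trans; zero; _-_)
  open LinearAlgebra ℝ
  open Rado ℝ
  open Coordinates ℝ
  open Incidence ℝ
  open Graph G

  -- The vectors u J stand for the coordinate bivectors e_i ∧ e_j.
  module _ (u : K → K → Carrier) (u-≡ : ∀ J → ¬ (u J J ≈ 0#)) (u-≢ : ∀ {J J′} → J′ ≢ J → u J J′ ≈ 0#)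
    (z : Fin ρ → K → Carrier) where

    cand : E → K → V × K → Carrier
    cand e J = diff (end₁ e) (end₂ e) (u J)

    boundary : Fin ρ → V × K → Carrier
    boundary r = single (R r) (z r)

    boundaries : Subset ρ → List (V × K → Carrier)
    boundaries B = map boundary (members B)

    module _
      (independent : ∀ v → ∣ R-at R v ∣ ≤ rk (map z (members (R-at R v))))
      (sparse : ∀ F → Nonempty F → ∣ F ∣ ℕ.+ ∣ R-on R F ∣ ≤
                (card K ℕ.* ∣ V⟨ F ⟩ ∣ ℕ.∸ card K) ℕ.+ rk (map z (members (R-on R F))))
      (F : Subset #E)
      where

      module _ (X : Subset #V) where

        -- Testing `end₁` settles both ends when `X` is `Closed`.
        inner? : ∀ e → Dec (e ∈ F × end₁ e ∈ X)
        inner? e = (e ∈? F) ×-dec (end₁ e ∈? X)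

        at? : ∀ r → Dec (R r ∈ X)
        at? r = R r ∈? X

        E-in : Subset #E
        E-in = comprehension inner?

        R-in : Subset ρ
        R-in = comprehension at?

        block : List (V × K → Carrier)
        block = spread cand E-in ++ boundaries R-in

        -- The unions of components of the graph `(V , F)`.
        Closed : Set
        Closed = ∀ {e} → e ∈ F → (end₁ e ∈ X → end₂ e ∈ X) × (end₂ e ∈ X → end₁ e ∈ X)

        ∈-E-in⁺ : ∀ {e} → e ∈ F → end₁ e ∈ X → e ∈ E-in
        ∈-E-in⁺ e∈F end∈X = ∈-comprehension⁺ inner? (e∈F , end∈X)

        block-supported : Closed → ∀ {x} → x ∈ˡ block → SupportedOn X x
        block-supported closed x∈ with ∈-++⁻ (spread cand E-in) x∈
        ... | inj₁ x∈ˡ with ∈-spread⁻ cand {E-in} x∈ˡ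
        ...   | e , J , e∈ , refl = let e∈F , end∈X = ∈-comprehension⁻ inner? e∈ in
          diff-supported (u J) end∈X (proj₁ (closed e∈F) end∈X)
        block-supported closed x∈ | inj₂ x∈ʳ with ∈-map⁻ boundary {xs = members R-in} x∈ʳ
        ...   | r , r∈ , refl = single-supported (z r) (∈-comprehension⁻ at? (∈-members⁻ {S = R-in} r∈))

      module _ {v : V} {Q : Subset #V} (v∈Q : v ∈ Q) (closed : Closed Q)
        (connected : ∀ {w} → w ∈ Q → ∀ J → Span (spread cand F) (diff w v (u J))) where

        -- Restriction to `Q` fixes the difference, keeps the candidates of edges inside `Q` and, as
        -- `Q` is closed, kills those of all other edges of `F`.
        connected-inside : ∀ {w} → w ∈ Q → ∀ J → Span (spread cand (E-in Q)) (diff w v (u J))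
        connected-inside w∈Q J = span-cong (λ p → ≈-sym (restrict-supported (diff-supported (u J) w∈Q v∈Q) p))
          (span-image (restrict-linear Q) (λ x∈ → restricted (∈-spread⁻ cand {F} x∈)) (connected w∈Q J))
          where
          restricted : ∀ {x} → (∃₂ λ e J → e ∈ F × x ≡ cand e J) → Span (spread cand (E-in Q)) (restrict Q x)
          restricted (e , J , e∈F , refl) with end₁ e ∈? Q
          ... | yes end∈ = span-cong
            (restrict-supported (diff-supported (u J) end∈ (proj₁ (closed e∈F) end∈)))
            (span-member (∈-spread⁺ cand {F = E-in Q} J (∈-E-in⁺ Q e∈F end∈)))
          ... | no end∉ = nil λ (w , J′) → vanish w J′
            where
            vanish : ∀ w J′ → restrict Q (cand e J) (w , J′) ≈ 0#
            vanish w J′ with w ∈? Q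
            ... | no _    = ≈-refl
            ... | yes w∈Q = diff-outside {u = w} (u J) J′ (λ { refl → end∉ w∈Q })
              (λ { refl → end∉ (proj₂ (closed e∈F) w∈Q) })

        -- Differences to the root `v` take the place of a spanning tree of `Q`.
        star : V × K → V × K → Carrier
        star (w , J) = diff w v (u J)

        positions : List (V × K)
        positions = cartesianProduct (members (Q - v)) elements

        ≢v : ∀ {w J} → (w , J) ∈ˡ positions → w ≢ v
        ≢v p∈ refl with ∈-cartesianProduct⁻ (members (Q - v)) elements p∈
        ... | w∈ , _ = x∈p─q⇒x∉q {p = Q} (∈-members⁻ {S = Q - v} w∈) (x∈⁅x⁆ v)

        -- Without the root the matrix is diagonal: among the listed vectors only `star (w , J)` is
        -- nonzero at `(w , J)`.
        star-rk : ∣ Q - v ∣ ℕ.* card K ≤ rk (map star positions)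
        star-rk = begin
          ∣ Q - v ∣ ℕ.* card K                    ≡⟨ cong (ℕ._* card K) (length-members (Q - v)) ⟨
          length (members (Q - v)) ℕ.* card K     ≡⟨ length-cartesianProduct (members (Q - v)) elements ⟨
          length positions                        ≤⟨ rk-diagonal (Unique.cartesianProduct⁺ (members-unique (Q - v)) unique)
                                                       (λ {p} p∈ → diagonal p p∈) (λ {p} {q} p∈ q∈ → off-diagonal p q q∈) ⟩
          rk (map star positions)                 ∎
          where
          open ℕ.≤-Reasoning
          diagonal : ∀ p → p ∈ˡ positions → ¬ (star p p ≈ 0#)
          diagonal (w , J) p∈ ≈0 = u-≡ J (≈-trans (≈-sym (diff-head (u J) J (≢v p∈))) ≈0)
          off-diagonal : ∀ p q → q ∈ˡ positions → q ≢ p → star p q ≈ 0#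
          off-diagonal (w , J) (w′ , J′) q∈ q≢p = case (w′ ≟ᶠ w) of λ
            { (no w′≢w)  → diff-outside (u J) J′ w′≢w (≢v q∈)
            ; (yes refl) → ≈-trans (diff-head (u J) J′ (≢v q∈)) (u-≢ λ { refl → q≢p refl })
            }

        -- `total` kills the star and carries the boundary rows to the vectors `z r`, so the two
        -- ranks add up inside the block.
        block-rk : rk (map z (members (R-in Q))) ℕ.+ ∣ Q - v ∣ ℕ.* card K ≤ rk (block Q)
        block-rk = begin
          rk (map z (members (R-in Q))) ℕ.+ ∣ Q - v ∣ ℕ.* card K
            ≤⟨ ℕ.+-mono-≤ (rk-mono λ x∈ → to-total (∈-map⁻ z {xs = members (R-in Q)} x∈)) star-rk ⟩
          rk (map total (boundaries (R-in Q))) ℕ.+ rk (map star positions)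
            ≤⟨ rk-linear total-linear (boundaries (R-in Q)) (λ x∈ → star-total (∈-map⁻ star {xs = positions} x∈)) ⟩
          rk (boundaries (R-in Q) ++ map star positions)
            ≤⟨ rk-mono (++-⊑ (λ x∈ → span-member (∈-++⁺ʳ (spread cand (E-in Q)) x∈))
                             (λ x∈ → star-block (∈-map⁻ star {xs = positions} x∈))) ⟩
          rk (block Q) ∎
          where
          open ℕ.≤-Reasoning
          to-total : ∀ {x} → (∃ λ r → r ∈ˡ members (R-in Q) × x ≡ z r) → Span (map total (boundaries (R-in Q))) x
          to-total (r , r∈ , refl) = span-cong (total-single (R r) (z r)) (span-member (∈-map⁺ total (∈-map⁺ boundary r∈)))
          star-total : ∀ {x} → (∃ λ p → p ∈ˡ positions × x ≡ star p) → total x ≐ 𝟘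
          star-total ((w , J) , _ , refl) = total-diff w v (u J)
          star-block : ∀ {x} → (∃ λ p → p ∈ˡ positions × x ≡ star p) → Span (block Q) x
          star-block ((w , J) , p∈ , refl) = span-mono ∈-++⁺ˡ (connected-inside
            (p─q⊆p Q ⁅ v ⁆ (∈-members⁻ {S = Q - v} (proj₁ (∈-cartesianProduct⁻ (members (Q - v)) elements p∈)))) J)

        vanishes-at-avoided : ∀ {w} → (∀ {e} → e ∈ E-in Q → w ≢ end₁ e × w ≢ end₂ e) →
          ∀ {a} → a ∈ Q → diff a v (u J₀) (w , J₀) ≈ 0#
        vanishes-at-avoided {w} avoided a∈Q =
          span-vanish (w , J₀) (λ x∈ → at-w (∈-spread⁻ cand {E-in Q} x∈)) (connected-inside a∈Q J₀)
          where
          at-w : ∀ {x} → (∃₂ λ e J → e ∈ E-in Q × x ≡ cand e J) → x (w , J₀) ≈ 0#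
          at-w (e , J , e∈ , refl) = let ≢₁ , ≢₂ = avoided e∈ in diff-outside (u J) J₀ ≢₁ ≢₂

        -- Replaces a path argument. If no edge touches `w`, everything spanned by the candidates
        -- vanishes at `w`, whereas the difference between `w` and a second vertex does not.
        isolated : ∀ {w} → w ∈ Q → (∀ {e} → e ∈ E-in Q → w ≢ end₁ e × w ≢ end₂ e) → ∀ {w′} → w′ ∈ Q → w′ ≡ w
        isolated {w} w∈Q avoided {w′} w′∈Q with w ≟ᶠ v | w′ ≟ᶠ w
        ... | _        | yes w′≡w = w′≡w
        ... | no w≢v   | no _     = ⊥-elim (u-≡ J₀
          (≈-trans (≈-sym (diff-head (u J₀) J₀ w≢v)) (vanishes-at-avoided avoided w∈Q)))
        -- Here `w` is the root itself and appears as the tail of `diff w′ v`, with coefficient -1.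
        ... | yes refl | no w′≢w  = ⊥-elim (u-≡ J₀ (-1*x≈0⇒x≈0
          (≈-trans (≈-sym (diff-tail (u J₀) J₀ (w′≢w ∘ sym))) (vanishes-at-avoided avoided w′∈Q))))

        -- Without edges, `isolated` reduces `Q` to the vertex `v`, and independence at `v` applies.
        -- With an edge, `Q` is exactly the vertex set of its edges, and sparsity applies.
        component-bound : ∣ E-in Q ∣ ℕ.+ ∣ R-in Q ∣ ≤ rk (block Q)
        component-bound with nonempty? (E-in Q)
        ... | no empty = begin
          ∣ E-in Q ∣ ℕ.+ ∣ R-in Q ∣       ≡⟨ cong (ℕ._+ ∣ R-in Q ∣) (Empty⇒∣S∣≡0 empty) ⟩
          ∣ R-in Q ∣                      ≤⟨ p⊆q⇒∣p∣≤∣q∣ {q = R-at R v} (λ r∈ → ∈-R-at⁺ G {R = R} (isolated v∈Q (λ e∈ → ⊥-elim (empty (_ , e∈)))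
                                               (∈-comprehension⁻ (at? Q) r∈))) ⟩
          ∣ R-at R v ∣                    ≤⟨ independent v ⟩
          rk (map z (members (R-at R v))) ≤⟨ rk-mono (λ x∈ → at-v (∈-map⁻ z {xs = members (R-at R v)} x∈)) ⟩
          rk (map z (members (R-in Q)))   ≤⟨ ℕ.m≤m+n _ _ ⟩
          rk (map z (members (R-in Q))) ℕ.+ ∣ Q - v ∣ ℕ.* card K ≤⟨ block-rk ⟩
          rk (block Q)                    ∎
          where
          open ℕ.≤-Reasoning
          at-v : ∀ {x} → (∃ λ r → r ∈ˡ members (R-at R v) × x ≡ z r) → Span (map z (members (R-in Q))) x
          at-v (r , r∈ , refl) = span-member (∈-map⁺ z (∈-members⁺ (∈-comprehension⁺ (at? Q)
            (subst (_∈ Q) (sym (∈-R-at⁻ G {R = R} (∈-members⁻ {S = R-at R v} r∈))) v∈Q))))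
        ... | yes (e₀ , e₀∈) = begin
          ∣ E-in Q ∣ ℕ.+ ∣ R-in Q ∣
            ≤⟨ ℕ.+-monoʳ-≤ ∣ E-in Q ∣ (p⊆q⇒∣p∣≤∣q∣ {q = R-on R (E-in Q)} (λ r∈ → ∈-R-on⁺ G {R = R} {E-in Q} (Q⊆V (∈-comprehension⁻ (at? Q) r∈)))) ⟩
          ∣ E-in Q ∣ ℕ.+ ∣ R-on R (E-in Q) ∣
            ≤⟨ sparse (E-in Q) (e₀ , e₀∈) ⟩
          (card K ℕ.* ∣ V⟨ E-in Q ⟩ ∣ ℕ.∸ card K) ℕ.+ rk (map z (members (R-on R (E-in Q))))
            ≤⟨ ℕ.+-mono-≤ vertices (rk-mono (λ x∈ → on-Q (∈-map⁻ z {xs = members (R-on R (E-in Q))} x∈))) ⟩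
          ∣ Q - v ∣ ℕ.* card K ℕ.+ rk (map z (members (R-in Q)))
            ≡⟨ ℕ.+-comm (∣ Q - v ∣ ℕ.* card K) _ ⟩
          rk (map z (members (R-in Q))) ℕ.+ ∣ Q - v ∣ ℕ.* card K
            ≤⟨ block-rk ⟩
          rk (block Q) ∎
          where
          open ℕ.≤-Reasoning
          end₁∈Q : ∀ {e} → e ∈ E-in Q → end₁ e ∈ Q
          end₁∈Q e∈ = proj₂ (∈-comprehension⁻ (inner? Q) e∈)
          end₂∈Q : ∀ {e} → e ∈ E-in Q → end₂ e ∈ Q
          end₂∈Q e∈ = proj₁ (closed (proj₁ (∈-comprehension⁻ (inner? Q) e∈))) (end₁∈Q e∈)
          V⊆Q : V⟨ E-in Q ⟩ ⊆ Q
          V⊆Q w∈ with ∈-V⟨⟩⁻ G {E-in Q} w∈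
          ... | _ , e∈ , inj₁ refl = end₁∈Q e∈
          ... | _ , e∈ , inj₂ refl = end₂∈Q e∈
          -- A vertex of `Q` missed by all edges would be the only vertex of `Q`, hence equal to
          -- `end₁ e₀`.
          Q⊆V : Q ⊆ V⟨ E-in Q ⟩
          Q⊆V {w} w∈Q = decidable-stable (w ∈? V⟨ E-in Q ⟩) λ w∉V →
            w∉V (∈-V⟨⟩⁺ G {E-in Q} e₀∈ (inj₁ (isolated w∈Q
              (λ e∈ → (λ { refl → w∉V (∈-V⟨⟩⁺ G {E-in Q} e∈ (inj₁ refl)) })
                    , (λ { refl → w∉V (∈-V⟨⟩⁺ G {E-in Q} e∈ (inj₂ refl)) })) (end₁∈Q e₀∈))))
          on-Q : ∀ {x} → (∃ λ r → r ∈ˡ members (R-on R (E-in Q)) × x ≡ z r) → Span (map z (members (R-in Q))) x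
          on-Q (r , r∈ , refl) = span-member (∈-map⁺ z (∈-members⁺ (∈-comprehension⁺ (at? Q)
            (V⊆Q (∈-R-on⁻ G {R = R} {E-in Q} (∈-members⁻ {S = R-on R (E-in Q)} r∈))))))
          ∣V∣≤ : ∣ V⟨ E-in Q ⟩ ∣ ≤ suc ∣ Q - v ∣
          ∣V∣≤ = begin
            ∣ V⟨ E-in Q ⟩ ∣             ≤⟨ p⊆q⇒∣p∣≤∣q∣ V⊆Q ⟩
            ∣ Q ∣                       ≤⟨ ∣S∣≤∣S─T∣+∣T∣ Q ⁅ v ⁆ ⟩
            ∣ Q - v ∣ ℕ.+ ∣ ⁅ v ⁆ ∣     ≡⟨ cong (∣ Q - v ∣ ℕ.+_) (∣⁅x⁆∣≡1 v) ⟩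
            ∣ Q - v ∣ ℕ.+ 1             ≡⟨ ℕ.+-comm ∣ Q - v ∣ 1 ⟩
            suc ∣ Q - v ∣               ∎
          -- The summand 1 in `∣V∣≤` is the copy of `card K` that the subtraction cancels.
          vertices : card K ℕ.* ∣ V⟨ E-in Q ⟩ ∣ ℕ.∸ card K ≤ ∣ Q - v ∣ ℕ.* card K
          vertices = begin
            card K ℕ.* ∣ V⟨ E-in Q ⟩ ∣ ℕ.∸ card K     ≤⟨ ℕ.∸-monoˡ-≤ (card K) (ℕ.*-monoʳ-≤ (card K) ∣V∣≤) ⟩
            card K ℕ.* suc ∣ Q - v ∣ ℕ.∸ card K       ≡⟨ cong (ℕ._∸ card K) (ℕ.*-comm (card K) (suc ∣ Q - v ∣)) ⟩
            card K ℕ.+ ∣ Q - v ∣ ℕ.* card K ℕ.∸ card K ≡⟨ ℕ.m+n∸m≡n (card K) (∣ Q - v ∣ ℕ.* card K) ⟩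
            ∣ Q - v ∣ ℕ.* card K                      ∎

      module _ (X : Subset #V) (v : V) where

        -- Connection to `v` is read off from spans, so `span?` decides it without a search for
        -- paths.
        connected? : ∀ w → Dec (w ∈ X × All.All (λ J → Span (spread cand F) (diff w v (u J))) elements)
        connected? w = (w ∈? X) ×-dec All.all? (λ J → span? (spread cand F) (diff w v (u J))) elements

        component : Subset #V
        component = comprehension connected?

        component-connected : ∀ {w} → w ∈ component → ∀ J → Span (spread cand F) (diff w v (u J))
        component-connected w∈ J = All.lookup (proj₂ (∈-comprehension⁻ connected? w∈)) (complete J)

        component⊆ : component ⊆ X
        component⊆ w∈ = proj₁ (∈-comprehension⁻ connected? w∈)

        component-self : v ∈ X → v ∈ component
        component-self v∈X = ∈-comprehension⁺ connected? (v∈X , All.tabulate λ {J} _ → nil (diff-self v (u J)))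

        -- The candidates of an edge are the differences between its ends, so they carry
        -- connectedness from one end to the other.
        component-closed : Closed X → Closed component
        component-closed closed {e} e∈F =
          (λ a∈ → ∈-comprehension⁺ connected? (proj₁ (closed e∈F) (component⊆ a∈) ,
            All.tabulate λ {J} _ → span-diff-trans (end₂ e) (end₁ e) v (u J)
              (span-diff-swap (end₂ e) (end₁ e) (u J) (edge J)) (component-connected a∈ J))) ,
          (λ b∈ → ∈-comprehension⁺ connected? (proj₂ (closed e∈F) (component⊆ b∈) ,
            All.tabulate λ {J} _ → span-diff-trans (end₁ e) (end₂ e) v (u J) (edge J) (component-connected b∈ J)))
          where
          edge : ∀ J → Span (spread cand F) (cand e J)
          edge J = span-member (∈-spread⁺ cand {F = F} J e∈F)

      -- Splits off one component `Q` at a time. The blocks of `Q` and of the remainder `Y` have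
      -- disjoint supports, so `restrict Q` makes their ranks add. The number `n` bounds the
      -- recursion.
      peel : ∀ n X → ∣ X ∣ ≤ n → Closed X → ∣ E-in X ∣ ℕ.+ ∣ R-in X ∣ ≤ rk (block X)
      peel-empty : ∀ X → Empty X → ∣ E-in X ∣ ℕ.+ ∣ R-in X ∣ ≤ rk (block X)
      peel-empty X empty = subst (_≤ rk (block X)) (sym (cong₂ ℕ._+_
        (Empty⇒∣S∣≡0 {S = E-in X} λ (e , e∈) → empty (_ , proj₂ (∈-comprehension⁻ (inner? X) e∈)))
        (Empty⇒∣S∣≡0 {S = R-in X} λ (r , r∈) → empty (_ , ∈-comprehension⁻ (at? X) r∈)))) z≤n
      peel zero X ∣X∣≤0 closed = peel-empty X λ (v , v∈X) →
        ℕ.<⇒≱ (ℕ.≤-trans (s≤s z≤n) (x∈p⇒∣p-x∣<∣p∣ v∈X)) ∣X∣≤0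
      peel (suc n) X ∣X∣≤n closed with nonempty? X
      ... | no empty = peel-empty X empty
      ... | yes (v , v∈X) = begin
        ∣ E-in X ∣ ℕ.+ ∣ R-in X ∣
          ≤⟨ ℕ.+-mono-≤ (∣∣-cover {S = E-in X} {E-in Q} {E-in Y} cover-E) (∣∣-cover {S = R-in X} {R-in Q} {R-in Y} cover-R) ⟩
        (∣ E-in Q ∣ ℕ.+ ∣ E-in Y ∣) ℕ.+ (∣ R-in Q ∣ ℕ.+ ∣ R-in Y ∣)
          ≡⟨ +-interchange (∣ E-in Q ∣) (∣ E-in Y ∣) (∣ R-in Q ∣) (∣ R-in Y ∣) ⟩
        (∣ E-in Q ∣ ℕ.+ ∣ R-in Q ∣) ℕ.+ (∣ E-in Y ∣ ℕ.+ ∣ R-in Y ∣)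
          ≤⟨ ℕ.+-mono-≤ (component-bound v∈Q closed-Q (component-connected X v))
               (peel n Y (ℕ.≤-pred (ℕ.≤-trans (p∩q≢∅⇒∣p─q∣<∣p∣ X Q (v , x∈p∩q⁺ (v∈X , v∈Q))) ∣X∣≤n)) closed-Y) ⟩
        rk (block Q) ℕ.+ rk (block Y)
          ≤⟨ ℕ.+-monoˡ-≤ (rk (block Y)) (rk-mono λ x∈ →
               span-cong (λ p → ≈-sym (restrict-supported (block-supported Q closed-Q x∈) p))
                 (span-member (∈-map⁺ (restrict Q) x∈))) ⟩
        rk (map (restrict Q) (block Q)) ℕ.+ rk (block Y)
          ≤⟨ rk-linear (restrict-linear Q) (block Q)
               (λ x∈ → restrict-disjoint {Y = Y} (block-supported Y closed-Y x∈) (λ w∈Q w∈Y → x∈p─q⇒x∉q {p = X} w∈Y w∈Q)) ⟩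
        rk (block Q ++ block Y)
          ≤⟨ rk-mono (++-⊑ (block-mono (component⊆ X v)) (block-mono (p─q⊆p X Q))) ⟩
        rk (block X) ∎
        where
        open ℕ.≤-Reasoning
        open import Algebra.Properties.CommutativeSemigroup ℕ.+-commutativeSemigroup using ()
          renaming (interchange to +-interchange)
        Q Y : Subset #V
        Q = component X v
        Y = X ─ Q
        v∈Q : v ∈ Q
        v∈Q = component-self X v v∈X
        closed-Q : Closed Q
        closed-Q = component-closed X v closed
        closed-Y : Closed Y
        closed-Y {e} e∈F =
          (λ a∈ → x∈p∧x∉q⇒x∈p─q (proj₁ (closed e∈F) (p─q⊆p X Q a∈)) (λ b∈Q → x∈p─q⇒x∉q {p = X} a∈ (proj₂ (closed-Q e∈F) b∈Q))) ,
          (λ b∈ → x∈p∧x∉q⇒x∈p─q (proj₂ (closed e∈F) (p─q⊆p X Q b∈)) (λ a∈Q → x∈p─q⇒x∉q {p = X} b∈ (proj₁ (closed-Q e∈F) a∈Q)))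
        cover : ∀ {w} → w ∈ X → w ∈ Q ⊎ w ∈ Y
        cover {w} w∈X with w ∈? Q
        ... | yes w∈Q = inj₁ w∈Q
        ... | no w∉Q  = inj₂ (x∈p∧x∉q⇒x∈p─q w∈X w∉Q)
        cover-E : ∀ {e} → e ∈ E-in X → e ∈ E-in Q ⊎ e ∈ E-in Y
        cover-E e∈ with ∈-comprehension⁻ (inner? X) e∈
        ... | e∈F , a∈X with cover a∈X
        ...   | inj₁ a∈Q = inj₁ (∈-E-in⁺ Q e∈F a∈Q)
        ...   | inj₂ a∈Y = inj₂ (∈-E-in⁺ Y e∈F a∈Y)
        cover-R : ∀ {r} → r ∈ R-in X → r ∈ R-in Q ⊎ r ∈ R-in Y
        cover-R r∈ with cover (∈-comprehension⁻ (at? X) r∈)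
        ... | inj₁ ∈Q = inj₁ (∈-comprehension⁺ (at? Q) ∈Q)
        ... | inj₂ ∈Y = inj₂ (∈-comprehension⁺ (at? Y) ∈Y)
        block-mono : ∀ {Z} → Z ⊆ X → block Z ⊑ block X
        block-mono {Z} Z⊆X = ++-⊑ (λ x∈ → edges (∈-spread⁻ cand {E-in Z} x∈))
                                  (λ x∈ → bars (∈-map⁻ boundary {xs = members (R-in Z)} x∈))
          where
          edges : ∀ {x} → (∃₂ λ e J → e ∈ E-in Z × x ≡ cand e J) → Span (block X) x
          edges (e , J , e∈ , refl) = let e∈F , a∈Z = ∈-comprehension⁻ (inner? Z) e∈ in
            span-member (∈-++⁺ˡ (∈-spread⁺ cand {F = E-in X} J (∈-E-in⁺ X e∈F (Z⊆X a∈Z))))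
          bars : ∀ {x} → (∃ λ r → r ∈ˡ members (R-in Z) × x ≡ boundary r) → Span (block X) x
          bars (r , r∈ , refl) = span-member (∈-++⁺ʳ (spread cand (E-in X)) (∈-map⁺ boundary (∈-members⁺
            (∈-comprehension⁺ (at? X) (Z⊆X (∈-comprehension⁻ (at? Z) (∈-members⁻ {S = R-in Z} r∈)))))))

      -- All boundary bars are counted, whatever `F` is: those away from `F` sit at isolated
      -- vertices of `(V , F)`, where independence takes over.
      rank-bound : ∣ F ∣ ℕ.+ ρ ≤ rk (spread cand F ++ boundaries ⊤)
      rank-bound = begin
        ∣ F ∣ ℕ.+ ρ
          ≤⟨ ℕ.+-mono-≤ (p⊆q⇒∣p∣≤∣q∣ λ e∈F → ∈-E-in⁺ ⊤ e∈F ∈⊤)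
               (ℕ.≤-trans (ℕ.≤-reflexive (sym (∣⊤∣≡n ρ)))
                 (p⊆q⇒∣p∣≤∣q∣ {p = ⊤} λ _ → ∈-comprehension⁺ (at? ⊤) ∈⊤)) ⟩
        ∣ E-in ⊤ ∣ ℕ.+ ∣ R-in ⊤ ∣
          ≤⟨ peel #V ⊤ (ℕ.≤-reflexive (∣⊤∣≡n #V)) (λ _ → (λ _ → ∈⊤) , (λ _ → ∈⊤)) ⟩
        rk (block ⊤)
          ≤⟨ rk-mono (++-⊑ (λ x∈ → edges (∈-spread⁻ cand {E-in ⊤} x∈)) (λ x∈ → bars (∈-map⁻ boundary {xs = members (R-in ⊤)} x∈))) ⟩
        rk (spread cand F ++ boundaries ⊤) ∎
        where
        open ℕ.≤-Reasoning
        edges : ∀ {x} → (∃₂ λ e J → e ∈ E-in ⊤ × x ≡ cand e J) → Span (spread cand F ++ boundaries ⊤) x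
        edges (e , J , e∈ , refl) = span-member (∈-++⁺ˡ (∈-spread⁺ cand {F = F} J (proj₁ (∈-comprehension⁻ (inner? ⊤) e∈))))
        bars : ∀ {x} → (∃ λ r → r ∈ˡ members (R-in ⊤) × x ≡ boundary r) → Span (spread cand F ++ boundaries ⊤) x
        bars (r , _ , refl) = span-member (∈-++⁺ʳ (spread cand F) (∈-map⁺ boundary (∈-members⁺ {S = ⊤} {r} ∈⊤)))

-- Coordinate bivectors and the Hodge dual.

∁-involutive : ∀ {n k l} (I : KSubset n k l) → ∁ (∁ I) ≡ I
∁-involutive []       = refl
∁-involutive (in∷ I)  = cong in∷_ (∁-involutive I)
∁-involutive (out∷ I) = cong out∷_ (∁-involutive I)

element-mono : ∀ {n k l} (I : KSubset n k l) {i j} → i <ᶠ j → element I i <ᶠ element I j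
element-mono (in∷ I)  {zero}  {suc j} _         = s≤s z≤n
element-mono (in∷ I)  {suc i} {suc j} (s≤s i<j) = s≤s (element-mono I i<j)
element-mono (out∷ I)                 i<j       = s≤s (element-mono I i<j)

element-injective : ∀ {n k l} (I I′ : KSubset n k l) → (∀ i → element I i ≡ element I′ i) → I ≡ I′
element-injective []       []        _  = refl
element-injective (in∷ I)  (in∷ I′)  eq = cong in∷_ (element-injective I I′ λ i → suc-injective (eq (suc i)))
element-injective (in∷ I)  (out∷ I′) eq with eq zero
... | ()
element-injective (out∷ I) (in∷ I′)  eq with eq zero
... | ()
element-injective (out∷ I) (out∷ I′) eq = cong out∷_ (element-injective I I′ λ i → suc-injective (eq i))

initial : ∀ k → KSubset k k 0
initial zero    = []
initial (suc k) = in∷ initial k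

module Exterior {c ℓ : Level} (ℝ : CompleteOrderedField c ℓ) where

  open CompleteOrderedField ℝ hiding (_≤_; refl; sym; trans; zero; _-_)
  open LinearAlgebra ℝ
  open Coordinates ℝ
  open import Algebra.Solver.Ring.NaturalCoefficients.Default commutativeSemiring
    using (solve; _:+_; _:*_; _:=_; con)
  open import Algebra.Properties.Ring ring using (-‿distribˡ-*; -‿distribʳ-*; -‿involutive; -0#≈0#)

  sign-square : ∀ n → sign ℝ n * sign ℝ n ≈ 1#
  sign-square zero    = *-identityˡ 1#
  sign-square (suc n) = ≈-trans (≈-sym (-‿distribˡ-* _ _))
    (≈-trans (-‿cong (≈-sym (-‿distribʳ-* _ _))) (≈-trans (-‿involutive _) (sign-square n)))

  scale-linear : ∀ {A B : Set} (s : B → Carrier) (g : B → A) → IsLinear (λ x b → s b * x (g b))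
  scale-linear s g = record
    { φ-cong = λ x≐y b → *-congˡ (x≐y (g b))
    ; φ-𝟘    = λ b → zeroʳ (s b)
    ; φ-axpy = λ t x y b → solve 4 (λ s t x y → s :* (t :* x :+ y) := t :* (s :* x) :+ s :* y) ≈-refl
                 (s b) t (x (g b)) (y (g b))
    }

  module _ {n k l : ℕ} where

    ★-linear : IsLinear (★ ℝ {n} {k} {l})
    ★-linear = scale-linear (λ J → sign ℝ (inversions (∁ J))) ∁

    -- The sign counts the inversions of `I`, where `★` would count those of `∁ I`; in `★⁻¹-★` the
    -- two signs are therefore equal and square to one.
    ★⁻¹ : (KSubset n l k → Carrier) → KSubset n k l → Carrier
    ★⁻¹ y I = sign ℝ (inversions I) * y (∁ I)

    ★⁻¹-linear : IsLinear ★⁻¹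
    ★⁻¹-linear = scale-linear (λ I → sign ℝ (inversions I)) ∁

    ★⁻¹-★ : ∀ x → ★⁻¹ (★ ℝ x) ≐ x
    ★⁻¹-★ x I rewrite ∁-involutive I =
      ≈-trans (≈-sym (*-assoc _ _ (x I))) (≈-trans (*-congʳ (sign-square (inversions I))) (*-identityˡ (x I)))

    ★-reflects-0 : ∀ x J → ★ ℝ {n} {k} {l} x J ≈ 0# → x (∁ J) ≈ 0#
    ★-reflects-0 x J ≈0 = ≈-trans (≈-sym (*-identityˡ _)) (≈-trans (*-congʳ (≈-sym (sign-square (inversions (∁ J)))))
      (≈-trans (*-assoc _ _ _) (≈-trans (*-congˡ ≈0) (zeroʳ _))))

  module _ {n l : ℕ} where

    bivector : KSubset n 2 l → KSubset n 2 l → Carrier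
    bivector I = _∧_ ℝ (unit (element I zero)) (unit (element I (suc zero)))

    private
      fst<snd : ∀ (I : KSubset n 2 l) → element I zero <ᶠ element I (suc zero)
      fst<snd I = element-mono I (s≤s z≤n)

      minus-zero : ∀ {x y z} → x ≈ z → y ≈ 0# → x + - y ≈ z
      minus-zero x≈z y≈0 = ≈-trans (+-cong x≈z (≈-trans (-‿cong y≈0) -0#≈0#)) (+-identityʳ _)

    bivector-≡ : ∀ I → bivector I I ≈ 1#
    bivector-≡ I = minus-zero
      (≈-trans (*-cong (unit-≡ (element I zero)) (unit-≡ (element I (suc zero)))) (*-identityˡ 1#))
      (≈-trans (*-congʳ (unit-≢ {p = element I zero} {element I (suc zero)}
        λ eq → <ᶠ-irrefl (sym eq) (fst<snd I))) (zeroˡ _))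

    -- A nonzero direct product forces `I′` to equal `I`; a nonzero crossed one would make the
    -- elements of `I′` those of `I` in decreasing order.
    bivector-≢ : ∀ {I I′} → I′ ≢ I → bivector I I′ ≈ 0#
    bivector-≢ {I} {I′} I′≢I = minus-zero direct crossed
      where
      i = element I zero
      j = element I (suc zero)
      i′ = element I′ zero
      j′ = element I′ (suc zero)
      direct : unit i i′ * unit j j′ ≈ 0#
      direct = case (i′ ≟ᶠ i) of λ
        { (no i′≢i)  → ≈-trans (*-congʳ (unit-≢ i′≢i)) (zeroˡ _)
        ; (yes i′≡i) → ≈-trans (*-congˡ (unit-≢ λ j′≡j → I′≢I (element-injective I′ I
                         λ { zero → i′≡i ; (suc zero) → j′≡j }))) (zeroʳ _)
        }
      crossed : unit i j′ * unit j i′ ≈ 0#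
      crossed = case (j′ ≟ᶠ i) of λ
        { (no j′≢i)  → ≈-trans (*-congʳ (unit-≢ j′≢i)) (zeroˡ _)
        ; (yes j′≡i) → ≈-trans (*-congˡ (unit-≢ λ i′≡j → <ᶠ-asym (fst<snd I)
                         (subst (_<ᶠ i) i′≡j (subst (i′ <ᶠ_) j′≡i (fst<snd I′))))) (zeroʳ _)
        }

  coordinatePlane : ∀ {d} → KSubset (suc d) 2 (d ℕ.∸ 1) → Gr₂ ℝ d
  coordinatePlane I = record
    { rep          = bivector I
    ; decomposable = unit (element I zero) , unit (element I (suc zero)) , λ _ → ≈-refl
    ; nonzero      = λ ≐𝟘 → 0≉1 (≈-trans (≈-sym (≐𝟘 I)) (bivector-≡ I))
    }

  rk-image : ∀ {A B : Set} {{_ : Finite A}} {{_ : Finite B}} {φ : (A → Carrier) → B → Carrier} →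
    IsLinear φ → ∀ L → rk (map φ L) ≤ rk L
  rk-image {φ = φ} lin L = begin
    rk (map φ L)               ≤⟨ ℕ.m≤m+n _ _ ⟩
    rk (map φ L) ℕ.+ rk []     ≤⟨ rk-linear lin L {[]} (λ ()) ⟩
    rk (L ++ [])               ≡⟨ cong rk (++-identityʳ L) ⟩
    rk L                       ∎
    where open ℕ.≤-Reasoning

  -- `★⁻¹` recovers the original vectors, and a linear map cannot raise the rank. It moves
  -- conditions on `b°` to the dual vectors in the rows.
  rk-★ : ∀ {n k l} {I : Set} (x : I → KSubset n k l → Carrier) is → rk (map x is) ≤ rk (map (λ i → ★ ℝ (x i)) is)
  rk-★ x is = ℕ.≤-trans (rk-mono λ v∈ → recover (∈-map⁻ x {xs = is} v∈)) (rk-image ★⁻¹-linear (map (λ i → ★ ℝ (x i)) is))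
    where
    recover : ∀ {v} → (∃ λ i → i ∈ˡ is × v ≡ x i) → Span (map ★⁻¹ (map (λ i → ★ ℝ (x i)) is)) v
    recover (i , i∈ , refl) = span-cong (★⁻¹-★ (x i)) (span-member (∈-map⁺ ★⁻¹ (∈-map⁺ (λ i → ★ ℝ (x i)) i∈)))

  ∘-linear : ∀ {A B Z : Set} {φ : (A → Carrier) → B → Carrier} {ψ : (B → Carrier) → Z → Carrier} →
    IsLinear ψ → IsLinear φ → IsLinear (λ x → ψ (φ x))
  ∘-linear {φ = φ} linψ linφ = record
    { φ-cong = λ x≐y → φ-cong linψ (φ-cong linφ x≐y)
    ; φ-𝟘    = λ a → ≈-trans (φ-cong linψ (φ-𝟘 linφ) a) (φ-𝟘 linψ a)
    ; φ-axpy = λ t x y a → ≈-trans (φ-cong linψ (φ-axpy linφ t x y) a) (φ-axpy linψ t (φ x) (φ y) a)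
    }

-- The rows of a framework, with motions as their annihilators.

module Frameworks {c ℓ : Level} (ℝ : CompleteOrderedField c ℓ) (d′ : ℕ) (G : Graph)
  {ρ : ℕ} (R : Fin ρ → Graph.V G) (b° : Fin ρ → Gr₂ ℝ (suc d′)) where

  open CompleteOrderedField ℝ hiding (_≤_; refl; sym; trans; zero; _-_)
  open LinearAlgebra ℝ
  open Rado ℝ
  open Coordinates ℝ
  open Incidence ℝ
  open Exterior ℝ
  open Graph G
  open import Algebra.Properties.Ring ring using (-1*x≈-x; -‿distribˡ-*)

  -- The coordinates of a motion at one vertex: its values have degree `d − 1`, which is `d′`.
  K : Set
  K = KSubset (suc (suc d′)) d′ 2

  -- Witness that `K` is inhabited: a coordinate at which `isolated` detects a nonzero difference,
  -- and the default choice in `rado-empty`.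
  J₀ : K
  J₀ = out∷ (out∷ initial d′)

  open Sparse ℝ J₀ G R using (rank-bound)

  D : ℕ
  D = suc (suc d′) C 2

  -- `K` consists of `d′`-subsets while `D` counts pairs; complementation matches them.
  card-K : card K ≡ D
  card-K = trans (length-allKSubsets (suc (suc d′)) d′ 2 (ℕ.+-comm 2 d′))
    (sym (nCk≡nC[n∸k] {2} {suc (suc d′)} (s≤s (s≤s z≤n))))

  card-V×K : card (V × K) ≡ D ℕ.* #V
  card-V×K = trans (length-cartesianProduct (allFin #V) elements)
    (trans (cong₂ ℕ._*_ (length-tabulate {n = #V} id) card-K) (ℕ.*-comm #V D))

  b°-vec : Fin ρ → KSubset (suc (suc d′)) 2 d′ → Carrier
  b°-vec r = rep (b° r)

  z : Fin ρ → K → Carrier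
  z r = ★ ℝ (b°-vec r)

  -- Up to sign, the unit vector at `J`.
  u : K → K → Carrier
  u J = ★ ℝ (bivector (∁ J))

  u-≡ : ∀ J → ¬ (u J J ≈ 0#)
  u-≡ J ≈0 = 0≉1 (≈-trans (≈-sym (★-reflects-0 (bivector (∁ J)) J ≈0)) (bivector-≡ (∁ J)))

  u-≢ : ∀ {J J′} → J′ ≢ J → u J J′ ≈ 0#
  u-≢ {J} {J′} J′≢J = ≈-trans (*-congˡ (bivector-≢ λ eq →
    J′≢J (trans (sym (∁-involutive J′)) (trans (cong ∁ eq) (∁-involutive J))))) (zeroʳ _)

  span-u : ∀ y → Span (map u elements) y
  span-u = rk⇒spanning (rk-diagonal unique (λ {p} _ → u-≡ p) (λ _ _ → u-≢))

  bar : Fin ρ → V × K → Carrier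
  bar r = single (R r) (z r)

  bars : Subset ρ → List (V × K → Carrier)
  bars B = map bar (members B)

  length-bars : ∀ B → length (bars B) ≡ ∣ B ∣
  length-bars B = trans (length-map bar (members B)) (length-members B)

  ⟨⟩-single : ∀ (m : V → K → Carrier) v y → ⟨_,_⟩ ℝ (m v) y ≈ dot (λ (w , J) → m w J) (single v y)
  ⟨⟩-single m v y = ≈-sym (begin
    dot (λ (w , J) → m w J) (single v y)
      ≈⟨ Σˡ-product (allFin #V) elements (λ (w , J) → m w J * single v y (w , J)) ⟩
    Σˡ (allFin #V) (λ w → Σˡ elements (λ J → m w J * single v y (w , J)))
      ≈⟨ Σˡ-single {f = λ w → Σˡ elements (λ J → m w J * single v y (w , J))} (Unique.allFin⁺ #V) (∈-allFin v)
           (λ {w} w≢v → Σˡ-zero elements λ {J} _ → ≈-trans (*-congˡ (single-≢ y J w≢v)) (zeroʳ (m w J))) ⟩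
    Σˡ elements (λ J → m v J * single v y (v , J))
      ≈⟨ Σˡ-cong elements (λ J → *-congˡ (single-≡ v y J)) ⟩
    ⟨_,_⟩ ℝ (m v) y ∎)
    where open import Relation.Binary.Reasoning.Setoid setoid

  -- Rewrites the condition of a bar as orthogonality to one row over `V × K`.
  ⟨⟩-diff : ∀ (m : V → K → Carrier) v w y →
    ⟨_,_⟩ ℝ (λ J → m v J + - m w J) y ≈ dot (λ (w , J) → m w J) (diff v w y)
  ⟨⟩-diff m v w y = begin
    Σˡ elements (λ J → (m v J + - m w J) * y J)
      ≈⟨ Σˡ-cong elements (λ J → ≈-trans (distribʳ (y J) (m v J) (- m w J)) (≈-trans (+-comm _ _)
           (+-congʳ (≈-trans (≈-sym (-‿distribˡ-* (m w J) (y J))) (≈-sym (-1*x≈-x _)))))) ⟩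
    Σˡ elements (axpy (- 1#) (λ J → m w J * y J) (λ J → m v J * y J))
      ≈⟨ Σˡ-axpy elements (- 1#) (λ J → m w J * y J) (λ J → m v J * y J) ⟩
    - 1# * ⟨_,_⟩ ℝ (m w) y + ⟨_,_⟩ ℝ (m v) y
      ≈⟨ +-cong (*-congˡ (⟨⟩-single m w y)) (⟨⟩-single m v y) ⟩
    - 1# * dot (λ (w , J) → m w J) (single w y) + dot (λ (w , J) → m w J) (single v y)
      ≈⟨ dot-axpy (λ (w , J) → m w J) (- 1#) (single w y) (single v y) ⟨
    dot (λ (w , J) → m w J) (diff v w y) ∎
    where open import Relation.Binary.Reasoning.Setoid setoid

  module _ (b : E → Gr₂ ℝ (suc d′)) where

    open Framework (framework {ℝ = ℝ} {d = suc d′} G R b b°)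
      using (IsInfinitesimalMotion; InfinitesimallyRigid; MinimallyInfinitesimallyRigid)

    edge : E → V × K → Carrier
    edge e = diff (end₁ e) (end₂ e) (★ ℝ (rep (b e)))

    edges : Subset #E → List (V × K → Carrier)
    edges A = map edge (members A)

    rows : Subset #E → Subset ρ → List (V × K → Carrier)
    rows A B = edges A ++ bars B

    length-rows : ∀ A B → length (rows A B) ≡ ∣ A ∣ ℕ.+ ∣ B ∣
    length-rows A B = trans (length-++ (edges A))
      (cong₂ ℕ._+_ (trans (length-map edge (members A)) (length-members A)) (length-bars B))

    edge∈ : ∀ {A B e} → e ∈ A → Span (rows A B) (edge e)
    edge∈ e∈A = span-member (∈-++⁺ˡ (∈-map⁺ edge (∈-members⁺ e∈A)))

    bar∈ : ∀ {A B r} → r ∈ B → Span (rows A B) (bar r)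
    bar∈ {A} r∈B = span-member (∈-++⁺ʳ (edges A) (∈-map⁺ bar (∈-members⁺ r∈B)))

    rows-⊑ : ∀ {A B L} → (∀ {e} → e ∈ A → Span L (edge e)) → (∀ {r} → r ∈ B → Span L (bar r)) → rows A B ⊑ L
    rows-⊑ {A} {B} {L} A⊑ B⊑ = ++-⊑ (λ x∈ → from-edge (∈-map⁻ edge {xs = members A} x∈))
                                   (λ x∈ → from-bar (∈-map⁻ bar {xs = members B} x∈))
      where
      from-edge : ∀ {x} → (∃ λ e → e ∈ˡ members A × x ≡ edge e) → Span L x
      from-edge (e , e∈ , refl) = A⊑ (∈-members⁻ {S = A} e∈)
      from-bar : ∀ {x} → (∃ λ r → r ∈ˡ members B × x ≡ bar r) → Span L x
      from-bar (r , r∈ , refl) = B⊑ (∈-members⁻ {S = B} r∈)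

    motion⇒annihilates : ∀ {A B m} → IsInfinitesimalMotion A B m →
      ∀ {x} → x ∈ˡ rows A B → dot (λ (v , J) → m v J) x ≈ 0#
    motion⇒annihilates {A} {B} {m} (on-edges , on-bars) x∈ with ∈-++⁻ (edges A) x∈
    ... | inj₁ x∈ˡ with ∈-map⁻ edge {xs = members A} x∈ˡ
    ...   | e , e∈ , refl = ≈-trans (≈-sym (⟨⟩-diff m (end₁ e) (end₂ e) (★ ℝ (rep (b e)))))
      (on-edges e (∈-members⁻ {S = A} e∈))
    motion⇒annihilates {A} {B} {m} (on-edges , on-bars) x∈ | inj₂ x∈ʳ with ∈-map⁻ bar {xs = members B} x∈ʳ
    ... | r , r∈ , refl = ≈-trans (≈-sym (⟨⟩-single m (R r) (z r)))
      (on-bars (R r) r (∈-R-at⁺ G {R = R} refl) (∈-members⁻ {S = B} r∈))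

    annihilates⇒motion : ∀ {A B} f → (∀ {x} → x ∈ˡ rows A B → dot f x ≈ 0#) →
      IsInfinitesimalMotion A B (λ v J → f (v , J))
    annihilates⇒motion {A} {B} f ann =
      (λ e e∈A → ≈-trans (⟨⟩-diff (λ v J → f (v , J)) (end₁ e) (end₂ e) (★ ℝ (rep (b e))))
        (ann (∈-++⁺ˡ (∈-map⁺ edge (∈-members⁺ e∈A))))) ,
      (λ v r r∈v r∈B → case ∈-R-at⁻ G {R = R} r∈v of λ
        { refl → ≈-trans (⟨⟩-single (λ v J → f (v , J)) (R r) (z r))
                   (ann (∈-++⁺ʳ (edges A) (∈-map⁺ bar (∈-members⁺ r∈B)))) })

    -- If the rows did not span, the annihilator from `spanning-or-annihilated` would be a nonzero
    -- motion.
    rigid⇒spanning : ∀ {A B} → InfinitesimallyRigid A B → ∀ x → Span (rows A B) x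
    rigid⇒spanning {A} {B} rigid with spanning-or-annihilated (rows A B)
    ... | inj₁ spans = spans
    ... | inj₂ (f , ann , (v , J) , f≉0) = ⊥-elim (f≉0 (rigid _ (annihilates⇒motion {A} {B} f ann) v J))

    spanning⇒rigid : ∀ {A B} → (∀ x → Span (rows A B) x) → InfinitesimallyRigid A B
    spanning⇒rigid {A} {B} spans m motion v J = ≈-trans (≈-sym (dot-unit (λ (v , J) → m v J) (v , J)))
      (dot-span (λ (v , J) → m v J) (motion⇒annihilates {A} {B} motion) (spans (unit (v , J))))

    -- Necessity of the three conditions.

    module Necessity (minimal : MinimallyInfinitesimallyRigid) where

      spanning : ∀ x → Span (rows ⊤ ⊤) x
      spanning = rigid⇒spanning {⊤} {⊤} (proj₁ minimal)

      -- A row spanned by the others could be removed without losing rigidity.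
      edge-irredundant : ∀ e → ¬ Span (rows (⊤ - e) ⊤) (edge e)
      edge-irredundant e e∈ = proj₁ (proj₂ minimal) e (spanning⇒rigid {⊤ - e} {⊤} λ x →
        span-trans (rows-⊑ {⊤} {⊤} (λ {e′} _ → other e′) (bar∈ {⊤ - e})) (spanning x))
        where
        other : ∀ e′ → Span (rows (⊤ - e) ⊤) (edge e′)
        other e′ with e′ ≟ᶠ e
        ... | yes refl = e∈
        ... | no e′≢e  = edge∈ {⊤ - e} {⊤} (x∈p∧x≢y⇒x∈p-y ∈⊤ e′≢e)

      bar-irredundant : ∀ r → ¬ Span (rows ⊤ (⊤ - r)) (bar r)
      bar-irredundant r r∈ = proj₂ (proj₂ minimal) r (spanning⇒rigid {⊤} {⊤ - r} λ x →
        span-trans (rows-⊑ {⊤} {⊤} (edge∈ {⊤} {⊤ - r}) (λ {r′} _ → other r′)) (spanning x))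
        where
        other : ∀ r′ → Span (rows ⊤ (⊤ - r)) (bar r′)
        other r′ with r′ ≟ᶠ r
        ... | yes refl = r∈
        ... | no r′≢r  = bar∈ {⊤} {⊤ - r} (x∈p∧x≢y⇒x∈p-y ∈⊤ r′≢r)

      bars-rk : ∀ B → ∣ B ∣ ≤ rk (bars B)
      bars-rk B = begin
        ∣ B ∣                                          ≡⟨ length-members B ⟨
        length (members B)                             ≤⟨ ℕ.m≤m+n _ _ ⟩
        length (members B) ℕ.+ rk {V × K} []           ≤⟨ rk-irredundant (members-unique B)
          (λ {r} {js} _ js⊆ r∈ → bar-irredundant r (span-trans (++-⊑ (λ x∈ → others r js js⊆ (∈-map⁻ bar {xs = js} x∈)) λ ()) r∈)) ⟩
        rk (bars B ++ [])                              ≡⟨ cong rk (++-identityʳ (bars B)) ⟩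
        rk (bars B)                                    ∎
        where
        open ℕ.≤-Reasoning
        others : ∀ r js → (∀ {j} → j ∈ˡ js → j ∈ˡ members B × j ≢ r) →
          ∀ {x} → (∃ λ j → j ∈ˡ js × x ≡ bar j) → Span (rows ⊤ (⊤ - r)) x
        others r js js⊆ (j , j∈ , refl) = bar∈ {⊤} {⊤ - r} (x∈p∧x≢y⇒x∈p-y ∈⊤ (proj₂ (js⊆ j∈)))

      -- Irredundance passes to subfamilies. The bars are counted first and the edges are added with
      -- the bars as base, following the two removal clauses of minimality.
      rows-rk : ∀ A B → ∣ A ∣ ℕ.+ ∣ B ∣ ≤ rk (rows A B)
      rows-rk A B = begin
        ∣ A ∣ ℕ.+ ∣ B ∣                      ≤⟨ ℕ.+-monoʳ-≤ ∣ A ∣ (bars-rk B) ⟩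
        ∣ A ∣ ℕ.+ rk (bars B)                ≡⟨ cong (ℕ._+ rk (bars B)) (length-members A) ⟨
        length (members A) ℕ.+ rk (bars B)   ≤⟨ rk-irredundant (members-unique A)
          (λ {e} {js} _ js⊆ e∈ → edge-irredundant e (span-trans
            (++-⊑ (λ x∈ → others e js js⊆ (∈-map⁻ edge {xs = js} x∈)) (λ x∈ → kept e (∈-map⁻ bar {xs = members B} x∈))) e∈)) ⟩
        rk (rows A B)                        ∎
        where
        open ℕ.≤-Reasoning
        others : ∀ e js → (∀ {j} → j ∈ˡ js → j ∈ˡ members A × j ≢ e) →
          ∀ {x} → (∃ λ j → j ∈ˡ js × x ≡ edge j) → Span (rows (⊤ - e) ⊤) x
        others e js js⊆ (j , j∈ , refl) = edge∈ {⊤ - e} {⊤} (x∈p∧x≢y⇒x∈p-y ∈⊤ (proj₂ (js⊆ j∈)))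
        kept : ∀ e {x} → (∃ λ r → r ∈ˡ members B × x ≡ bar r) → Span (rows (⊤ - e) ⊤) x
        kept e (r , _ , refl) = bar∈ {⊤ - e} {⊤} ∈⊤

      count : #E ℕ.+ ρ ≡ D ℕ.* #V
      count = ℕ.≤-antisym
        (begin
          #E ℕ.+ ρ                            ≡⟨ cong₂ ℕ._+_ (∣⊤∣≡n #E) (∣⊤∣≡n ρ) ⟨
          ∣ ⊤ {#E} ∣ ℕ.+ ∣ ⊤ {ρ} ∣            ≤⟨ rows-rk ⊤ ⊤ ⟩
          rk (rows ⊤ ⊤)                       ≤⟨ rk-mono (λ {x} _ → span-by-units (λ p → span-member (∈-map⁺ unit (complete p))) x) ⟩
          rk {V × K} (map unit elements)      ≤⟨ rk≤length (map unit elements) ⟩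
          length {A = V × K → Carrier} (map unit elements)  ≡⟨ length-map (unit {A = V × K}) elements ⟩
          card (V × K)                        ≡⟨ card-V×K ⟩
          D ℕ.* #V                            ∎)
        (begin
          D ℕ.* #V                            ≡⟨ card-V×K ⟨
          card (V × K)                        ≤⟨ spanning⇒rk spanning ⟩
          rk (rows ⊤ ⊤)                       ≤⟨ rk≤length (rows ⊤ ⊤) ⟩
          length (rows ⊤ ⊤)                   ≡⟨ length-rows ⊤ ⊤ ⟩
          ∣ ⊤ {#E} ∣ ℕ.+ ∣ ⊤ {ρ} ∣            ≡⟨ cong₂ ℕ._+_ (∣⊤∣≡n #E) (∣⊤∣≡n ρ) ⟩
          #E ℕ.+ ρ                            ∎)
        where open ℕ.≤-Reasoning

      anchored-linear : ∀ (v : V) → IsLinear (λ x → single v (★ ℝ {suc (suc d′)} {2} {d′} x))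
      anchored-linear v = ∘-linear (single-linear v) ★-linear

      -- The rows of the bars at `v` are the images of their bivectors under one linear map, which
      -- cannot raise the rank.
      independent-at : ∀ v → LinearlyIndependent ℝ (R-at R v) b°-vec
      independent-at v = rk⇒independent (begin
        ∣ R-at R v ∣                                      ≤⟨ bars-rk (R-at R v) ⟩
        rk (bars (R-at R v))                              ≤⟨ rk-mono (λ x∈ → at-v (∈-map⁻ bar {xs = members (R-at R v)} x∈)) ⟩
        rk (map anchored (map b°-vec (members (R-at R v)))) ≤⟨ rk-image (anchored-linear v) _ ⟩
        rk (map b°-vec (members (R-at R v)))              ∎)
        where
        open ℕ.≤-Reasoning
        anchored : (KSubset (suc (suc d′)) 2 d′ → Carrier) → V × K → Carrier
        anchored x = single v (★ ℝ x)
        at-v : ∀ {x} → (∃ λ r → r ∈ˡ members (R-at R v) × x ≡ bar r) →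
          Span (map anchored (map b°-vec (members (R-at R v)))) x
        at-v (r , r∈ , refl) = subst (λ w → Span (map anchored (map b°-vec (members (R-at R v)))) (single w (z r))) (sym (∈-R-at⁻ G {R = R} (∈-members⁻ {S = R-at R v} r∈)))
          (span-member (∈-map⁺ anchored (∈-map⁺ b°-vec r∈)))

      -- The independent rows of `F` and its boundary bars all lie in the span of the differences to
      -- a root `v` and of a basis for the boundary bivectors, placed at `v`. Counting these
      -- generators gives the right-hand side.
      sparse : ∀ F → Nonempty F → ∃ λ k → HasDimension ℝ (InSpan ℝ (R-on R F) b°-vec) k
        × ∣ F ∣ ℕ.+ ∣ R-on R F ∣ ≤ (D ℕ.* ∣ V⟨ F ⟩ ∣ ℕ.∸ D) ℕ.+ k
      sparse F (e₀ , e₀∈F) = length B , span-dimension (R-on R F) b°-vec , (begin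
        ∣ F ∣ ℕ.+ ∣ R-on R F ∣                   ≤⟨ rows-rk F (R-on R F) ⟩
        rk (rows F (R-on R F))                   ≤⟨ rk-mono (rows-⊑ {F} {R-on R F} edge-spanned bar-spanned) ⟩
        rk generators                            ≤⟨ rk≤length generators ⟩
        length generators                        ≡⟨ length-generators ⟩
        ∣ V⟨ F ⟩ - v ∣ ℕ.* card K ℕ.+ length B   ≤⟨ ℕ.+-monoˡ-≤ (length B) vertices ⟩
        (D ℕ.* ∣ V⟨ F ⟩ ∣ ℕ.∸ D) ℕ.+ length B    ∎)
        where
        open ℕ.≤-Reasoning
        B = basis (map b°-vec (members (R-on R F)))
        v = end₁ e₀
        v∈ : v ∈ V⟨ F ⟩
        v∈ = ∈-V⟨⟩⁺ G {F} e₀∈F (inj₁ refl)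
        star : V × K → V × K → Carrier
        star (w , J) = diff w v (u J)
        anchored : (KSubset (suc (suc d′)) 2 d′ → Carrier) → V × K → Carrier
        anchored x = single v (★ ℝ x)
        positions : List (V × K)
        positions = cartesianProduct (members (V⟨ F ⟩ - v)) elements
        generators : List (V × K → Carrier)
        generators = map star positions ++ map anchored B
        length-generators : length generators ≡ ∣ V⟨ F ⟩ - v ∣ ℕ.* card K ℕ.+ length B
        length-generators = trans (length-++ (map star positions)) (cong₂ ℕ._+_
          (trans (length-map star positions) (trans (length-cartesianProduct (members (V⟨ F ⟩ - v)) elements)
            (cong (ℕ._* card K) (length-members (V⟨ F ⟩ - v)))))
          (length-map anchored B))
        to-v : ∀ {w} → w ∈ V⟨ F ⟩ → ∀ y → Span generators (diff w v y)
        to-v {w} w∈ y with w ≟ᶠ v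
        ... | yes refl = nil (diff-self v y)
        -- An arbitrary `y` expands in the vectors `u J`, so `card K` differences per vertex
        -- suffice.
        ... | no w≢v   = span-image (diff-linear w v) (λ x∈ → from-u (∈-map⁻ u {xs = elements} x∈)) (span-u y)
          where
          from-u : ∀ {x} → (∃ λ J → J ∈ˡ elements × x ≡ u J) → Span generators (diff w v x)
          from-u (J , J∈ , refl) = span-member (∈-++⁺ˡ (∈-map⁺ star
            (∈-cartesianProduct⁺ (∈-members⁺ (x∈p∧x≢y⇒x∈p-y w∈ w≢v)) J∈)))
        edge-spanned : ∀ {e} → e ∈ F → Span generators (edge e)
        -- The edge is routed through the root.
        edge-spanned {e} e∈F = span-diff-trans (end₁ e) v (end₂ e) y
          (to-v (∈-V⟨⟩⁺ G {F} e∈F (inj₁ refl)) y)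
          (span-diff-swap v (end₂ e) y (to-v (∈-V⟨⟩⁺ G {F} e∈F (inj₂ refl)) y))
          where y = ★ ℝ (rep (b e))
        bar-spanned : ∀ {r} → r ∈ R-on R F → Span generators (bar r)
        -- Moving the bar from `R r` to the root costs one difference, which the star supplies.
        bar-spanned {r} r∈ = span-single (R r) v (z r) (to-v (∈-R-on⁻ G {R = R} {F} r∈) (z r))
          (span-image (anchored-linear v) (λ x∈ → span-member (∈-++⁺ʳ (map star positions) (∈-map⁺ anchored x∈)))
            (basis-spans _ (∈-map⁺ b°-vec (∈-members⁺ r∈))))
        vertices : ∣ V⟨ F ⟩ - v ∣ ℕ.* card K ≤ D ℕ.* ∣ V⟨ F ⟩ ∣ ℕ.∸ D
        vertices = begin
          ∣ V⟨ F ⟩ - v ∣ ℕ.* card K               ≡⟨ cong (∣ V⟨ F ⟩ - v ∣ ℕ.*_) card-K ⟩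
          ∣ V⟨ F ⟩ - v ∣ ℕ.* D                    ≡⟨ ℕ.m+n∸m≡n D (∣ V⟨ F ⟩ - v ∣ ℕ.* D) ⟨
          suc ∣ V⟨ F ⟩ - v ∣ ℕ.* D ℕ.∸ D          ≡⟨ cong (ℕ._∸ D) (ℕ.*-comm (suc ∣ V⟨ F ⟩ - v ∣) D) ⟩
          D ℕ.* suc ∣ V⟨ F ⟩ - v ∣ ℕ.∸ D          ≤⟨ ℕ.∸-monoˡ-≤ D (ℕ.*-monoʳ-≤ D (x∈p⇒∣p-x∣<∣p∣ v∈)) ⟩
          D ℕ.* ∣ V⟨ F ⟩ ∣ ℕ.∸ D                  ∎

  -- Sufficiency: choosing the bars.

  module Sufficiency
    (independent : ∀ v → LinearlyIndependent ℝ (R-at R v) b°-vec)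
    (sparse : ∀ F → Nonempty F → ∃ λ k → HasDimension ℝ (InSpan ℝ (R-on R F) b°-vec) k
      × ∣ F ∣ ℕ.+ ∣ R-on R F ∣ ≤ (D ℕ.* ∣ V⟨ F ⟩ ∣ ℕ.∸ D) ℕ.+ k)
    (count : #E ℕ.+ ρ ≡ D ℕ.* #V)
    where

    cand : E → K → V × K → Carrier
    cand e J = diff (end₁ e) (end₂ e) (u J)

    -- Conditions (1) and (2) enter as ranks of the dual vectors `z r`: a witnessed dimension `k` is
    -- at most such a rank.
    bound : ∀ F → ∣ F ∣ ℕ.+ ρ ≤ rk (spread cand F ++ bars ⊤)
    bound = rank-bound u u-≡ u-≢ z
      (λ v → ℕ.≤-trans (independent⇒rk (independent v)) (rk-★ b°-vec (members (R-at R v))))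
      λ F ne → let k , dim , ≤k = sparse F ne in
        subst (λ D → ∣ F ∣ ℕ.+ ∣ R-on R F ∣ ≤ (D ℕ.* ∣ V⟨ F ⟩ ∣ ℕ.∸ D) ℕ.+ rk (map z (members (R-on R F)))) (sym card-K)
          (ℕ.≤-trans ≤k (ℕ.+-monoʳ-≤ (D ℕ.* ∣ V⟨ F ⟩ ∣ ℕ.∸ D)
            (ℕ.≤-trans (dimension⇒rk {S = R-on R F} dim) (rk-★ b°-vec (members (R-on R F))))))

    rk-bars≤ : rk (bars ⊤) ≤ ρ
    rk-bars≤ = ℕ.≤-trans (rk≤length (bars ⊤)) (ℕ.≤-reflexive (trans (length-bars ⊤) (∣⊤∣≡n ρ)))

    -- The bound for the empty edge set says that the boundary rows are independent.
    ρ≤rk-bars : ρ ≤ rk (bars ⊤)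
    ρ≤rk-bars = begin
      ρ                                ≡⟨ cong (ℕ._+ ρ) (∣⊥∣≡0 #E) ⟨
      ∣ ⊥ {#E} ∣ ℕ.+ ρ                 ≤⟨ bound ⊥ ⟩
      rk (spread cand ⊥ ++ bars ⊤)     ≤⟨ rk-mono (++-⊑ (λ x∈ → ⊥-elim (none (∈-spread⁻ cand {⊥} x∈))) span-member) ⟩
      rk (bars ⊤)                      ∎
      where
      open ℕ.≤-Reasoning
      none : ∀ {x} → ¬ (∃₂ λ e J → e ∈ ⊥ × x ≡ cand e J)
      none (_ , _ , e∈⊥ , _) = ∉⊥ e∈⊥

    transversal : ∃ λ f → ∣ ⊤ {#E} ∣ ℕ.+ rk (bars ⊤) ≤ rk (chosen cand f ⊤ ++ bars ⊤)
    transversal = rado cand J₀ #E ⊤ (bars ⊤) (ℕ.≤-reflexive (∣⊤∣≡n #E))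
      -- The bound has `ρ` where Rado's condition has `rk (bars ⊤)`, which is no larger.
      λ F _ → ℕ.≤-trans (ℕ.+-monoʳ-≤ ∣ F ∣ rk-bars≤) (bound F)

    -- The complement undoes the one in `u`, so the row of each bar is literally the chosen
    -- candidate, and `rows b ⊤ ⊤` is the list in `transversal`.
    b : E → Gr₂ ℝ (suc d′)
    b e = coordinatePlane (∁ (proj₁ transversal e))

    spanning : ∀ x → Span (rows b ⊤ ⊤) x
    spanning = rk⇒spanning (begin
      card (V × K)                        ≡⟨ card-V×K ⟩
      D ℕ.* #V                            ≡⟨ count ⟨
      #E ℕ.+ ρ                            ≤⟨ ℕ.+-mono-≤ (ℕ.≤-reflexive (sym (∣⊤∣≡n #E))) ρ≤rk-bars ⟩
      ∣ ⊤ {#E} ∣ ℕ.+ rk (bars ⊤)          ≤⟨ proj₂ transversal ⟩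
      rk (rows b ⊤ ⊤)                     ∎)
      where open ℕ.≤-Reasoning

    -- By `count`, a subfamily missing any bar has fewer rows than the dimension it would have to
    -- span.
    too-few : ∀ {A B} → ∣ A ∣ ℕ.+ ∣ B ∣ < #E ℕ.+ ρ →
      ¬ Framework.InfinitesimallyRigid (framework {ℝ = ℝ} {d = suc d′} G R b b°) A B
    too-few {A} {B} few rigid = ℕ.<-irrefl refl (begin-strict
      card (V × K)           ≤⟨ spanning⇒rk (rigid⇒spanning b {A} {B} rigid) ⟩
      rk (rows b A B)        ≤⟨ rk≤length (rows b A B) ⟩
      length (rows b A B)    ≡⟨ length-rows b A B ⟩
      ∣ A ∣ ℕ.+ ∣ B ∣        <⟨ few ⟩
      #E ℕ.+ ρ               ≡⟨ count ⟩
      D ℕ.* #V               ≡⟨ card-V×K ⟨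
      card (V × K)           ∎)
      where open ℕ.≤-Reasoning

    ∣⊤-x∣< : ∀ {n} (x : Fin n) → ∣ ⊤ - x ∣ < n
    ∣⊤-x∣< {n} x = subst (∣ ⊤ - x ∣ <_) (∣⊤∣≡n n) (x∈p⇒∣p-x∣<∣p∣ {x = x} {p = ⊤} ∈⊤)

    minimallyRigid : Framework.MinimallyInfinitesimallyRigid (framework {ℝ = ℝ} {d = suc d′} G R b b°)
    minimallyRigid = spanning⇒rigid b {⊤} {⊤} spanning ,
      (λ e → too-few {⊤ - e} {⊤} (ℕ.+-mono-<-≤ (∣⊤-x∣< e) (ℕ.≤-reflexive (∣⊤∣≡n ρ)))) ,
      (λ r → too-few {⊤} {⊤ - r} (ℕ.+-mono-≤-< (ℕ.≤-reflexive (∣⊤∣≡n #E)) (∣⊤-x∣< r)))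

open import Data.Nat.Base using (_+_; _*_; _∸_)

theorem6p1 : ∀ {c ℓ} (ℝ : CompleteOrderedField c ℓ) (d : ℕ) .{{_ : NonZero d}} →
    let D = suc d C 2 in
    (G : Graph) → let open Graph G in
    ∀ {ρ : ℕ} (R : Fin ρ → V) (b° : Fin ρ → Gr₂ ℝ d) →
    let b°-vec = λ r → rep (b° r) in
    (∃ λ (b : E → Gr₂ ℝ d) →
    Framework.MinimallyInfinitesimallyRigid (framework {ℝ = ℝ} {d = d} G R b b°))
    ⇔
    ( (∀ v → LinearlyIndependent ℝ (R-at R v) b°-vec)
    × (∀ F → Nonempty F →
    ∃ λ k → HasDimension ℝ (InSpan ℝ (R-on R F) b°-vec) k
    × ∣ F ∣ + ∣ R-on R F ∣ ≤ (D * ∣ V⟨ F ⟩ ∣ ∸ D) + k)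
    × #E + ρ ≡ D * #V )
-- `NonZero d` leaves only successors, for which `d ∸ 1` computes to `d′`.
theorem6p1 ℝ (suc d′) G R b° = mk⇔
  (λ (b , minimal) → let open Necessity b minimal in independent-at , sparse , count)
  (λ (independent , sparse , count) → let open Sufficiency independent sparse count in b , minimallyRigid)
  where open Frameworks ℝ d′ G R b°
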